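{- There is an absolute constant $C>0$ such that for all integers $n$ and $r$ with $5\leq r<n$, \[ \left|\kappa(n,r)-\mathrm{e}^{ -H_r}\right|\leq C\,\frac{\nu(n,r)}{r}. \] (That is, $\kappa(n,r)=\mathrm{e}^{ -H_r}+O\bigl(\nu(n,r)/r\bigr)$ uniformly in this range.)
   Context: For integers $1\leq r<n$, $\kappa(n,r)$ denotes the probability that a permutation chosen uniformly at random from the symmetric group $\mathrm{S}_n$ has no cycles of length less than $r+1$ (i.e. all its cycles have length $>r$), and $\nu(n,r)$ denotes the probability that a permutation chosen uniformly at random from $\mathrm{S}_n$ has no cycles of length greater than $r$. $H_r=\sum_{j=1}^r 1/j$ is the $r$-th harmonic number. -}

module Defs where

open import Data.Bool using (Bool; true; false; if_then_else_; _∧_; _∨_; not)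
open import Data.Nat as ℕ using (ℕ; zero; suc; _!)
open import Data.Nat.Properties using (_!≢0)
open import Data.Fin using (Fin; zero; suc; _≟_)
open import Data.Vec using (Vec; []; _∷_; lookup)
open import Data.List using (List; []; _∷_; [_]; map; concatMap; allFin; filterᵇ; length; foldr)
open import Data.Integer using (+_)
open import Data.Rational using (ℚ; _/_; _+_; _-_; _*_; -_; _≤_; _<_; 0ℚ; 1ℚ)
open import Data.Product using (∃-syntax; _×_)
open import Relation.Nullary.Decidable using (⌊_⌋)

-- Permutations of {0,…,n-1}, represented as their value tables
-- (σ i = lookup σ i), enumerated as all injective maps Fin n → Fin n.

allᵇ : {A : Set} → (A → Bool) → List A → Bool
allᵇ p = foldr (λ x b → p x ∧ b) true

allVecs : (n m : ℕ) → List (Vec (Fin n) m)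
allVecs n zero    = [ [] ]
allVecs n (suc m) = concatMap (λ v → map (_∷ v) (allFin n)) (allVecs n m)

isInjective : {n : ℕ} → Vec (Fin n) n → Bool
isInjective {n} σ =
  allᵇ (λ i → allᵇ (λ j → not ⌊ lookup σ i ≟ lookup σ j ⌋ ∨ ⌊ i ≟ j ⌋) (allFin n)) (allFin n)

-- the symmetric group S_n, as a list of its elements (each exactly once)
perms : (n : ℕ) → List (Vec (Fin n) n)
perms n = filterᵇ isInjective (allVecs n n)

iter : {n : ℕ} → Vec (Fin n) n → ℕ → Fin n → Fin n
iter σ zero    i = i
iter σ (suc k) i = lookup σ (iter σ k i)

-- length of the cycle of σ containing i: the least k ≥ 1 with σ^k(i) = i
-- (searched among k = 1,…,n, which always suffices for a permutation)
cycleLen : {n : ℕ} → Vec (Fin n) n → Fin n → ℕ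
cycleLen {n} σ i = go n 1
  where
  go : ℕ → ℕ → ℕ
  go zero    k = k
  go (suc f) k = if ⌊ iter σ k i ≟ i ⌋ then k else go f (suc k)

allCyclesLongerThan : ℕ → {n : ℕ} → Vec (Fin n) n → Bool
allCyclesLongerThan r {n} σ = allᵇ (λ i → r ℕ.<ᵇ cycleLen σ i) (allFin n)

noCycleLongerThan : ℕ → {n : ℕ} → Vec (Fin n) n → Bool
noCycleLongerThan r {n} σ = allᵇ (λ i → cycleLen σ i ℕ.≤ᵇ r) (allFin n)

probS : (n : ℕ) → (Vec (Fin n) n → Bool) → ℚ
probS n P = (+ length (filterᵇ P (perms n)) / (n !)) {{n !≢0}}

κ : ℕ → ℕ → ℚ
κ n r = probS n (allCyclesLongerThan r)

ν : ℕ → ℕ → ℚ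
ν n r = probS n (noCycleLongerThan r)

-- 1/m (with the junk value 0 for m = 0; only used with m ≥ 1)
inv : ℕ → ℚ
inv zero    = 0ℚ
inv (suc m) = + 1 / suc m

H : ℕ → ℚ
H zero    = 0ℚ
H (suc r) = H r + inv (suc r)

powℚ : ℚ → ℕ → ℚ
powℚ x zero    = 1ℚ
powℚ x (suc k) = powℚ x k * x

expNegPartial : ℚ → ℕ → ℚ
expNegPartial x zero    = 1ℚ
expNegPartial x (suc N) =
  expNegPartial x N + powℚ (- x) (suc N) * (+ 1 / (suc N !)) {{suc N !≢0}}

-- For a convergent rational sequence s:  lim s ≤ c   resp.   c ≤ lim s
LimLeq : (ℕ → ℚ) → ℚ → Set
LimLeq s c = ∀ (ε : ℚ) → 0ℚ < ε → ∃[ N ] (∀ M → N ℕ.≤ M → s M ≤ c + ε)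

LimGeq : (ℕ → ℚ) → ℚ → Set
LimGeq s c = ∀ (ε : ℚ) → 0ℚ < ε → ∃[ N ] (∀ M → N ℕ.≤ M → c - ε ≤ s M)

-- | e^{-x} - a | ≤ b, where e^{-x} = lim_N expNegPartial x N
AbsDiffExpNegLeq : ℚ → ℚ → ℚ → Set
AbsDiffExpNegLeq x a b = LimGeq (expNegPartial x) (a - b) × LimLeq (expNegPartial x) (a + b)

-- Let P(z) = z + z²/2 + … + z^r/r. Then ν(n,r) is the coefficient of z^n in exp P(z), and κ(n,r)
-- that of exp(-P(z))/(1 - z), i.e. the partial sum a₀ + … + aₙ of the coefficients of exp(-P(z)).
-- The full sum is exp(-P(1)) = e^{-H_r}, so the error is a tail of (a_k). Writing v_k for the
-- coefficients of exp P(z), differentiation gives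
--   k a_k = -(a_{k-1} + … + a_{k-r})   and   k v_k = v_{k-1} + … + v_{k-r}.
-- For r + 2 ≤ k ≤ 2r + 1 one has |a_k| = 1/(k(k-1)) ≤ 1/r² while v_k ≥ 1/6, hence |a_k| ≤ 6 v_k/r²
-- there, and by the two recurrences for all k ≥ r + 2. Finally v is nonincreasing with
-- v_{n+r} ≤ v_n/2 for n ≥ r, so the tail of v beyond n ≥ r is at most 2r v_n.
--
-- The recurrences for permutations come from exploring a permutation along its cycles, one value
-- at a time.
module Submission where

open import Defs
open import Data.Bool using (Bool; true; false; T; _∧_; _∨_; not; if_then_else_)
import Data.Bool.Properties as Bool
open import Data.List as List using (List; []; _∷_; _++_; length; map; concatMap; allFin; filter; filterᵇ)
open import Data.Nat as ℕ using (ℕ; zero; suc; z≤n; s≤s; _!)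
import Data.Nat.Properties as ℕ
open import Data.Product using (∃; ∃-syntax; _×_; _,_; proj₁; proj₂)
open import Data.Sum using (_⊎_; inj₁; inj₂; [_,_])
open import Function using (_∘_; id)
open import Function.Bundles using (Equivalence; Injection)
open import Relation.Nullary using (¬_; yes; no; does; contradiction)
open import Relation.Nullary.Decidable using (⌊_⌋; _×-dec_; _→-dec_; dec-true; dec-false; dec⇒maybe; T?)
open import Relation.Binary.PropositionalEquality hiding ([_])

-- Instead, the M-th partial sum is the polynomial ∑_{j ≤ M} (-P)^j/j! at z = 1. Its coefficients of
-- index at most M are the a_k. The higher ones are incomplete, but at most v_k in absolute value,
-- so together at most 2r v_M, which tends to 0. The range where a_k and v_k are compared directly
-- has exactly the length r of the recurrences. It cannot start before r + 2, because a_{r+1} = 1/(r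
-- + 1) is not O(1/r²); as the error begins with a_{n+1}, this is where r < n enters. The final
-- constant is 12 = 6 · 2. Splitting a permutation by the cycle of one point would leave
-- permutations of the complement, to be relabelled. Exploration value by value stays inside the one
-- list of vectors over `Fin n`; the point is that the number of completions depends only on the
-- number of untouched points and the length of the current path.

module Counting where

  open import Data.Nat using (_+_; _*_; _<_; _≤_)
  open import Algebra.Properties.Semiring.Sum ℕ.+-*-semiring
    using (sum; sum-cong-≗; ∑-distrib-+; *-distribʳ-sum; sum-replicate-zero)
  open import Data.Fin using (Fin; zero; suc; _≟_)
  open import Data.Fin.Permutation using (Permutation′; _⟨$⟩ʳ_; _⟨$⟩ˡ_; _∘ₚ_; transpose; inverseʳ)
    renaming (id to idₚ)
  open import Data.Fin.Properties using (all?)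
  open import Data.List.Properties using (filter-≐; filter-none; filter-++; length-++)
  import Data.List.Relation.Unary.All as All
  open import Data.Vec using (Vec; []; _∷_; lookup; tabulate)
  open import Data.Vec.Properties using (≡-dec; lookup∘tabulate; tabulate-cong; tabulate∘lookup)
  open import Function.Properties.Inverse using (↔⇒↣)
  open import Relation.Unary using (Decidable)

  private variable
    A : Set
    n : ℕ

  -- Counting list entries that satisfy a decidable predicate

  𝟙 : Bool → ℕ
  𝟙 b = if b then 1 else 0

  # : {P : A → Set} → Decidable P → List A → ℕ
  # P? xs = length (filter P? xs)

  #-∷ : {P : A → Set} (P? : Decidable P) (x : A) (xs : List A) → # P? (x ∷ xs) ≡ 𝟙 (does (P? x)) + # P? xs
  #-∷ P? x xs with does (P? x)
  ... | true  = refl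
  ... | false = refl

  #-cong : {P Q : A → Set} (P? : Decidable P) (Q? : Decidable Q) →
           (∀ {x} → P x → Q x) → (∀ {x} → Q x → P x) → ∀ xs → # P? xs ≡ # Q? xs
  #-cong P? Q? P⇒Q Q⇒P xs = cong length (filter-≐ P? Q? (P⇒Q , Q⇒P) xs)

  #-none : {P : A → Set} (P? : Decidable P) → (∀ {x} → ¬ P x) → ∀ xs → # P? xs ≡ 0
  #-none P? ¬P xs = cong length (filter-none P? (All.universal (λ _ → ¬P) xs))

  #-++ : {P : A → Set} (P? : Decidable P) (xs ys : List A) → # P? (xs ++ ys) ≡ # P? xs + # P? ys
  #-++ P? xs ys = trans (cong length (filter-++ P? xs ys)) (length-++ (filter P? xs))

  filterᵇ-filterᵇ : (p q : A → Bool) (xs : List A) → filterᵇ p (filterᵇ q xs) ≡ filterᵇ (λ x → q x ∧ p x) xs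
  filterᵇ-filterᵇ p q []       = refl
  filterᵇ-filterᵇ p q (x ∷ xs) with q x
  ... | false = filterᵇ-filterᵇ p q xs
  ... | true with p x
  ...   | false = filterᵇ-filterᵇ p q xs
  ...   | true  = cong (x ∷_) (filterᵇ-filterᵇ p q xs)

  sum-indicator : (i : Fin n) → sum (λ j → 𝟙 (does (i ≟ j))) ≡ 1
  sum-indicator {suc n} zero    = cong suc (sum-replicate-zero n)
  sum-indicator         (suc i) = sum-indicator i

  #-split : {P : A → Set} (P? : Decidable P) (f : A → Fin n) (xs : List A) →
            # P? xs ≡ sum (λ j → # (λ x → P? x ×-dec (f x ≟ j)) xs)
  #-split {n = n} P? f []   = sym (sum-replicate-zero n)
  #-split {n = n} P? f (x ∷ xs) = begin
    # P? (x ∷ xs)                                      ≡⟨ #-∷ P? x xs ⟩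
    𝟙 b + # P? xs                                      ≡⟨ cong₂ _+_ (head b) (#-split P? f xs) ⟩
    sum (λ j → 𝟙 (b ∧ does (f x ≟ j))) + sum tail         ≡⟨ ∑-distrib-+ (λ j → 𝟙 (b ∧ does (f x ≟ j))) tail ⟨
    sum (λ j → 𝟙 (b ∧ does (f x ≟ j)) + tail j)           ≡⟨ sum-cong-≗ (λ j → #-∷ (λ y → P? y ×-dec (f y ≟ j)) x xs) ⟨
    sum (λ j → # (λ y → P? y ×-dec (f y ≟ j)) (x ∷ xs)) ∎
    where
    open ≡-Reasoning
    b = does (P? x)
    tail = λ j → # (λ y → P? y ×-dec (f y ≟ j)) xs
    head : ∀ b → 𝟙 b ≡ sum (λ j → 𝟙 (b ∧ does (f x ≟ j)))
    head true  = sym (sum-indicator (f x))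
    head false = sym (sum-replicate-zero n)

  #-map : {B : Set} {P : B → Set} (P? : Decidable P) (f : A → B) (xs : List A) → # P? (map f xs) ≡ # (P? ∘ f) xs
  #-map P? f []       = refl
  #-map P? f (x ∷ xs) with does (P? (f x))
  ... | true  = cong suc (#-map P? f xs)
  ... | false = #-map P? f xs

  #-tabulate : {P : A → Set} (P? : Decidable P) (f : Fin n → A) → # P? (List.tabulate f) ≡ sum (λ i → 𝟙 (does (P? (f i))))
  #-tabulate {n = zero}  P? f = refl
  #-tabulate {n = suc n} P? f = trans (#-∷ P? (f zero) (List.tabulate (f ∘ suc))) (cong (𝟙 (does (P? (f zero))) +_) (#-tabulate P? (f ∘ suc)))

  -- This makes an exploration in which all values are known count exactly once.
  #-allVecs-≡ : (m : ℕ) (v : Vec (Fin n) m) → # (λ w → ≡-dec _≟_ v w) (allVecs n m) ≡ 1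
  #-allVecs-≡ zero []          = refl
  #-allVecs-≡ {n} (suc m) (i ∷ v) = trans (extend (allVecs n m)) (#-allVecs-≡ m v)
    where
    open ≡-Reasoning
    one : ∀ b → sum (λ j → 𝟙 (does (i ≟ j) ∧ b)) ≡ 𝟙 b
    one true  = trans (sum-cong-≗ (λ j → cong 𝟙 (Bool.∧-identityʳ (does (i ≟ j))))) (sum-indicator i)
    one false = trans (sum-cong-≗ (λ j → cong 𝟙 (Bool.∧-zeroʳ (does (i ≟ j))))) (sum-replicate-zero n)
    extend : ∀ ws → # (≡-dec _≟_ (i ∷ v)) (concatMap (λ w → map (_∷ w) (allFin n)) ws) ≡ # (≡-dec _≟_ v) ws
    extend []       = refl
    extend (w ∷ ws) = begin
      # (≡-dec _≟_ (i ∷ v)) (map (_∷ w) (allFin n) ++ rest)              ≡⟨ #-++ (≡-dec _≟_ (i ∷ v)) (map (_∷ w) (allFin n)) rest ⟩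
      # (≡-dec _≟_ (i ∷ v)) (map (_∷ w) (allFin n)) + # (≡-dec _≟_ (i ∷ v)) rest
        ≡⟨ cong₂ _+_ (trans (#-map (≡-dec _≟_ (i ∷ v)) (_∷ w) (allFin n)) (trans (#-tabulate (λ j → ≡-dec _≟_ (i ∷ v) (j ∷ w)) id) (one (does (≡-dec _≟_ v w))))) (extend ws) ⟩
      𝟙 (does (≡-dec _≟_ v w)) + # (≡-dec _≟_ v) ws                      ≡⟨ #-∷ (≡-dec _≟_ v) w ws ⟨
      # (≡-dec _≟_ v) (w ∷ ws)                                           ∎
      where rest = concatMap (λ w → map (_∷ w) (allFin n)) ws

  -- Cycle lengths of injective vectors

  Injective : Vec (Fin n) n → Set
  Injective σ = ∀ i j → lookup σ i ≡ lookup σ j → i ≡ j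

  module Search where

    search : Vec (Fin n) n → Fin n → ℕ → ℕ → ℕ
    search σ i zero    k = k
    search σ i (suc f) k = if ⌊ iter σ k i ≟ i ⌋ then k else search σ i f (suc k)

    -- The fuel of the local search in cycleLen is tied to the size n. Abstracting suc m in the
    -- unfolded goal separates the two, so that unification finds the omitted left-hand side.
    mutual
      cycleLen≡search : (σ : Vec (Fin n) n) (i : Fin n) → cycleLen σ i ≡ search σ i n 1
      cycleLen≡search {suc m} σ i with suc m | 2
      ... | n | k with ⌊ iter σ 1 i ≟ i ⌋
      ...   | true  = refl
      ...   | false = separated m n σ i k

      separated : ∀ m n (σ : Vec (Fin n) n) i k → _ ≡ search σ i m k
      separated zero    n σ i k = refl
      separated (suc m) n σ i k with ⌊ iter σ k i ≟ i ⌋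
      ... | true  = refl
      ... | false = separated m n σ i (suc k)

    iter-lookup : (σ : Vec (Fin n) n) (k : ℕ) (i : Fin n) → iter σ k (lookup σ i) ≡ iter σ (suc k) i
    iter-lookup σ zero    i = refl
    iter-lookup σ (suc k) i = cong (lookup σ) (iter-lookup σ k i)

    -- Since σ^k (σ i) = σ (σ^k i), injectivity makes σ^k fix σ i exactly when it fixes i, so both
    -- searches stop at the same step.
    search-lookup : (σ : Vec (Fin n) n) → Injective σ → ∀ i f k → search σ (lookup σ i) f k ≡ search σ i f k
    search-lookup σ inj i zero    k = refl
    search-lookup σ inj i (suc f) k with iter σ k (lookup σ i) ≟ lookup σ i | iter σ k i ≟ i
    ... | yes _  | yes _  = refl
    ... | no _   | no _   = search-lookup σ inj i f (suc k)
    ... | yes p  | no ¬q  = contradiction (inj _ _ (trans (sym (iter-lookup σ k i)) p)) ¬q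
    ... | no ¬p  | yes q  = contradiction (trans (iter-lookup σ k i) (cong (lookup σ) q)) ¬p

    search-first : (σ : Vec (Fin n) n) (i : Fin n) (f k l : ℕ) → k ≤ l → l < k + f →
                   (∀ j → k ≤ j → j < l → iter σ j i ≢ i) → iter σ l i ≡ i → search σ i f k ≡ l
    search-first σ i zero    k l k≤l l<k+f _ _ =
      contradiction (ℕ.<-≤-trans l<k+f (ℕ.≤-trans (ℕ.≤-reflexive (ℕ.+-identityʳ k)) k≤l)) (ℕ.<-irrefl refl)
    search-first σ i (suc f) k l k≤l l<k+f first fix with iter σ k i ≟ i
    ... | yes p with ℕ.m≤n⇒m<n∨m≡n k≤l
    ...   | inj₁ k<l = contradiction p (first k ℕ.≤-refl k<l)
    ...   | inj₂ k≡l = k≡l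
    search-first σ i (suc f) k l k≤l l<k+f first fix | no ¬p with ℕ.m≤n⇒m<n∨m≡n k≤l
    ...   | inj₁ k<l = search-first σ i f (suc k) l k<l (subst (l <_) (ℕ.+-suc k f) l<k+f)
                         (λ j k<j → first j (ℕ.<⇒≤ k<j)) fix
    ...   | inj₂ refl = contradiction fix ¬p

    cycleLen-lookup : (σ : Vec (Fin n) n) → Injective σ → ∀ i → cycleLen σ (lookup σ i) ≡ cycleLen σ i
    cycleLen-lookup {n} σ inj i = begin
      cycleLen σ (lookup σ i)     ≡⟨ cycleLen≡search σ (lookup σ i) ⟩
      search σ (lookup σ i) n 1   ≡⟨ search-lookup σ inj i n 1 ⟩
      search σ i n 1              ≡⟨ cycleLen≡search σ i ⟨
      cycleLen σ i                ∎
      where open ≡-Reasoning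

    cycleLen-first : (σ : Vec (Fin n) n) (i : Fin n) (k : ℕ) → suc k ≤ n →
                     (∀ j → j < k → iter σ (suc j) i ≢ i) → iter σ (suc k) i ≡ i → cycleLen σ i ≡ suc k
    cycleLen-first {n} σ i k k<n first fix = trans (cycleLen≡search σ i)
      (search-first σ i n 1 (suc k) (s≤s z≤n) (s≤s k<n) (λ { (suc j) _ (s≤s j<k) → first j j<k }) fix)

  open Search using (cycleLen-lookup; cycleLen-first)

  -- Finite subsets and transpositions

  ∣_∣ : (Fin n → Bool) → ℕ
  ∣ U ∣ = sum (𝟙 ∘ U)

  _-_ : (Fin n → Bool) → Fin n → Fin n → Bool
  (U - e) x = U x ∧ not (does (e ≟ x))

  ∣-∣ : (U : Fin n → Bool) (e : Fin n) → U e ≡ true → ∣ U ∣ ≡ suc ∣ U - e ∣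
  ∣-∣ U e Ue = begin
    sum (𝟙 ∘ U)                                       ≡⟨ sum-cong-≗ split ⟩
    sum (λ x → 𝟙 (does (e ≟ x)) + 𝟙 ((U - e) x))      ≡⟨ ∑-distrib-+ (λ x → 𝟙 (does (e ≟ x))) (𝟙 ∘ (U - e)) ⟩
    sum (λ x → 𝟙 (does (e ≟ x))) + ∣ U - e ∣          ≡⟨ cong (_+ ∣ U - e ∣) (sum-indicator e) ⟩
    suc ∣ U - e ∣                                     ∎
    where
    open ≡-Reasoning
    split : ∀ x → 𝟙 (U x) ≡ 𝟙 (does (e ≟ x)) + 𝟙 ((U - e) x)
    split x with e ≟ x
    ... | yes refl rewrite Ue = refl
    ... | no  _    = cong 𝟙 (sym (Bool.∧-identityʳ (U x)))

  ∣∣≡0 : (U : Fin n → Bool) → ∣ U ∣ ≡ 0 → ∀ x → U x ≡ false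
  ∣∣≡0 U empty x with U x in eq
  ... | false = refl
  ... | true  = contradiction (trans (sym (∣-∣ U x eq)) empty) λ ()

  ∣∣≡suc : (U : Fin n → Bool) {m : ℕ} → ∣ U ∣ ≡ suc m → ∃ λ x → U x ≡ true
  ∣∣≡suc {suc n} U size with U zero in eq
  ... | true  = zero , eq
  ... | false = let x , Ux = ∣∣≡suc (U ∘ suc) size in suc x , Ux

  -≡false : (U : Fin n → Bool) (e x : Fin n) → (U - e) x ≡ false → U x ≡ false ⊎ x ≡ e
  -≡false U e x eq with U x | e ≟ x
  ... | false | _       = inj₁ refl
  ... | true  | yes e≡x = inj₂ (sym e≡x)
  ... | true  | no _    = contradiction eq λ ()

  ∉-- : (U : Fin n → Bool) (e : Fin n) → (U - e) e ≡ false
  ∉-- U e rewrite dec-true (e ≟ e) refl = Bool.∧-zeroʳ (U e)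

  ∉⇒∉- : (U : Fin n → Bool) (e x : Fin n) → U x ≡ false → (U - e) x ≡ false
  ∉⇒∉- U e x eq rewrite eq = refl

  ∈-⇒∈ : (U : Fin n → Bool) (e x : Fin n) → (U - e) x ≡ true → U x ≡ true × x ≢ e
  ∈-⇒∈ U e x eq with U x | e ≟ x
  ... | true | no e≢x = refl , e≢x ∘ sym

  ∈⇒∈- : (U : Fin n → Bool) (e x : Fin n) → U x ≡ true → x ≢ e → (U - e) x ≡ true
  ∈⇒∈- U e x x∈U x≢e rewrite x∈U | dec-false (e ≟ x) (x≢e ∘ sym) = refl

  ⟨$⟩ʳ-injective : (τ : Permutation′ n) {x y : Fin n} → τ ⟨$⟩ʳ x ≡ τ ⟨$⟩ʳ y → x ≡ y
  ⟨$⟩ʳ-injective τ = Injection.injective (↔⇒↣ τ)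

  transposeˡ : (e u : Fin n) → transpose e u ⟨$⟩ʳ e ≡ u
  transposeˡ e u rewrite dec-true (e ≟ e) refl = refl

  transposeʳ : (e u : Fin n) → transpose e u ⟨$⟩ʳ u ≡ e
  transposeʳ e u with u ≟ e
  ... | yes u≡e = u≡e
  ... | no  _ rewrite dec-true (u ≟ u) refl = refl

  transpose-≢ : (e u : Fin n) {x : Fin n} → x ≢ e → x ≢ u → transpose e u ⟨$⟩ʳ x ≡ x
  transpose-≢ e u {x} x≢e x≢u rewrite dec-false (x ≟ e) x≢e | dec-false (x ≟ u) x≢u = refl

  -- Counting permutations by exploring their cycles

  module Exploration (p : ℕ → Bool) where

    -- The number of ways to complete an exploration of a permutation with m untouched points:
    -- closed# m if all explored cycles are finished, open# m k if there is also an unfinished path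
    -- of k + 1 points, which may be closed or extended to any untouched point.
    mutual
      closed# : ℕ → ℕ
      closed# zero    = 1
      closed# (suc m) = open# m 0

      open# : ℕ → ℕ → ℕ
      open# m k = 𝟙 (p (suc k)) * closed# m + m * extended# m k

      extended# : ℕ → ℕ → ℕ
      -- Default value, multiplied by m = 0 in `open#`. Splitting off the predecessor here keeps the
      -- recursion structural.
      extended# zero    k = 0
      extended# (suc m) k = open# m (suc k)

    Good : Vec (Fin n) n → Set
    Good σ = ∀ x → p (cycleLen σ x) ≡ true

    -- A partially explored σ is encoded by a permutation τ with σ = τ at the points outside U, where
    -- τ fixes the untouched points and closes up the unfinished path, if any.
    Agree : Permutation′ n → (Fin n → Bool) → Vec (Fin n) n → Set
    Agree τ U σ = ∀ x → U x ≡ false → lookup σ x ≡ τ ⟨$⟩ʳ x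

    Fits : Permutation′ n → (Fin n → Bool) → Vec (Fin n) n → Set
    Fits τ U σ = Injective σ × Good σ × Agree τ U σ

    fits? : (τ : Permutation′ n) (U : Fin n → Bool) → Decidable (Fits τ U)
    fits? τ U σ =
      (all? λ i → all? λ j → (lookup σ i ≟ lookup σ j) →-dec (i ≟ j)) ×-dec
      (all? λ x → p (cycleLen σ x) Bool.≟ true) ×-dec
      (all? λ x → (U x Bool.≟ false) →-dec (lookup σ x ≟ τ ⟨$⟩ʳ x))

    completions : Permutation′ n → (Fin n → Bool) → ℕ
    completions {n} τ U = # (fits? τ U) (allVecs n n)

    Fixes : Permutation′ n → (Fin n → Bool) → Set
    Fixes τ U = ∀ x → U x ≡ true → τ ⟨$⟩ʳ x ≡ x

    -- Asking this of every completion avoids listing the finished cycles: once they are closed, the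
    -- values outside `U` determine their lengths.
    ClosedGood : Permutation′ n → (Fin n → Bool) → Set
    ClosedGood τ U = ∀ σ → Injective σ → Agree τ U σ → ∀ x → U x ≡ false → p (cycleLen σ x) ≡ true

    -- The elements x outside F together with e are those already explored: s, …, σ^k s = e form
    -- the unfinished path, the other ones lie on finished cycles.
    OpenPath : Permutation′ n → (Fin n → Bool) → Fin n → Fin n → ℕ → Set
    OpenPath τ F s e k = ∀ σ → Injective σ → Agree τ F σ →
      iter σ k s ≡ e ×
      (∀ j → j < k → iter σ (suc j) s ≢ s) ×
      (∀ x → F x ≡ false ⊎ x ≡ e → p (cycleLen σ x) ≡ true ⊎ cycleLen σ x ≡ cycleLen σ s)

    -- With every value prescribed only the table of `τ` remains, and `ClosedGood` vouches for its
    -- cycles.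
    completions-full : (τ : Permutation′ n) (U : Fin n → Bool) → (∀ x → U x ≡ false) → ClosedGood τ U →
                       completions τ U ≡ 1
    completions-full {n} τ U full good = trans
      (#-cong (fits? τ U) (≡-dec _≟_ v) (λ { {σ} (_ , _ , agree) → to σ agree }) from (allVecs n n))
      (#-allVecs-≡ n v)
      where
      v = tabulate (τ ⟨$⟩ʳ_)
      to : ∀ σ → Agree τ U σ → v ≡ σ
      to σ agree = trans (tabulate-cong λ x → sym (agree x (full x))) (tabulate∘lookup σ)
      agree : Agree τ U v
      agree x _ = lookup∘tabulate (τ ⟨$⟩ʳ_) x
      inj : Injective v
      inj i j eq = ⟨$⟩ʳ-injective τ (trans (sym (agree i (full i))) (trans eq (agree j (full j))))
      from : ∀ {σ} → v ≡ σ → Fits τ U σ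
      from refl = inj , (λ x → good v inj agree x (full x)) , agree

    -- The counts forget which part has been explored. In `OpenClaim`, `F` consists of the m
    -- untouched points and the end `e` of the path, whose value is still free. The bound k + suc m
    -- ≤ n ensures that the cycle of k + 1 points obtained by closing the path lies within the range
    -- searched by `cycleLen`.
    ClosedClaim OpenClaim : ℕ → ℕ → Set
    ClosedClaim n m = (τ : Permutation′ n) (U : Fin n → Bool) → m ≤ n →
      ∣ U ∣ ≡ m → Fixes τ U → ClosedGood τ U → completions τ U ≡ closed# m
    OpenClaim n m = (k : ℕ) (τ : Permutation′ n) (F : Fin n → Bool) (s e : Fin n) → k + suc m ≤ n →
      ∣ F ∣ ≡ suc m → F e ≡ true → τ ⟨$⟩ʳ e ≡ s → (∀ x → F x ≡ true → x ≢ e → τ ⟨$⟩ʳ x ≡ x) →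
      OpenPath τ F s e k → completions τ F ≡ open# m k

    -- Declaring an untouched point to be a path of one point reveals no value of σ, so the set of
    -- completions stays literally the same.
    start-path : {m : ℕ} → OpenClaim n m → ClosedClaim n (suc m)
    start-path claim τ U m≤n size fixes good with ∣∣≡suc U size
    ... | e , Ue = claim 0 τ U e e m≤n size Ue (fixes e Ue) (λ x Ux _ → fixes x Ux)
      λ σ inj agree → refl , (λ _ ()) ,
        λ { x (inj₁ Ux) → inj₁ (good σ inj agree x Ux) ; x (inj₂ refl) → inj₂ refl }

    -- Completions are sorted by the value y of σ at `e`: y = s closes the path, an untouched y
    -- extends it, and any other y is already taken.
    continue-path : {m : ℕ} → ClosedClaim n m → (∀ {m′} → m ≡ suc m′ → OpenClaim n m′) → OpenClaim n m
    continue-path {n} {m} closed-claim open-claim k τ F s e k+m<n size Fe τe≡s fixes path = begin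
        completions τ F                                        ≡⟨ #-split (fits? τ F) (λ σ → lookup σ e) (allVecs n n) ⟩
        sum (λ y → # (branch? y) (allVecs n n))                ≡⟨ sum-cong-≗ branch ⟩
        sum (λ y → 𝟙 (does (s ≟ y)) * closing + 𝟙 (U y) * extending)         ≡⟨ ∑-distrib-+ (λ y → 𝟙 (does (s ≟ y)) * closing) (λ y → 𝟙 (U y) * extending) ⟩
        sum (λ y → 𝟙 (does (s ≟ y)) * closing) + sum (λ y → 𝟙 (U y) * extending)
          ≡⟨ cong₂ _+_ (*-distribʳ-sum closing (λ y → 𝟙 (does (s ≟ y)))) (*-distribʳ-sum extending (𝟙 ∘ U)) ⟨
        sum (λ y → 𝟙 (does (s ≟ y))) * closing + ∣ U ∣ * extending           ≡⟨ cong₂ (λ a b → a * closing + b * extending) (sum-indicator s) ∣U∣≡m ⟩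
        1 * closing + m * extending                                          ≡⟨ cong (_+ m * extending) (ℕ.*-identityˡ closing) ⟩
        closing + m * extending                                              ∎
        where
        open ≡-Reasoning
        closing = 𝟙 (p (suc k)) * closed# m
        extending = extended# m k
        U = F - e
        ∣U∣≡m : ∣ U ∣ ≡ m
        ∣U∣≡m = ℕ.suc-injective (trans (sym (∣-∣ F e Fe)) size)
        branch? : ∀ y → Decidable (λ σ → Fits τ F σ × lookup σ e ≡ y)
        branch? y σ = fits? τ F σ ×-dec (lookup σ e ≟ y)

        cycle : ∀ σ → Injective σ → Agree τ F σ → lookup σ e ≡ s → cycleLen σ s ≡ suc k
        cycle σ inj agree closes = let end , first , _ = path σ inj agree in
          cycleLen-first σ s k (ℕ.≤-trans (ℕ.m≤m+n (suc k) m) (subst (_≤ n) (ℕ.+-suc k m) k+m<n)) first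
            (trans (cong (lookup σ) end) closes)

        -- `τ` already sends `e` to `s`, so closing the path keeps `τ` and merely removes `e` from
        -- `F`.
        agree-after : ∀ σ → Agree τ F σ → lookup σ e ≡ s → Agree τ U σ
        agree-after σ agree closes x x∉U with -≡false F e x x∉U
        ... | inj₁ x∉F  = agree x x∉F
        ... | inj₂ refl = trans closes (sym τe≡s)

        agree-before : ∀ σ → Agree τ U σ → Agree τ F σ × lookup σ e ≡ s
        agree-before σ agree = (λ x x∉F → agree x (∉⇒∉- F e x x∉F)) , trans (agree e (∉-- F e)) τe≡s

        close : # (branch? s) (allVecs n n) ≡ closing
        close with p (suc k) in eq
        ... | false = #-none (branch? s)
          (λ { {σ} ((inj , good , agree) , closes) → contradiction
                 (trans (sym (good s)) (trans (cong p (cycle σ inj agree closes)) eq)) λ () }) (allVecs n n)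
        ... | true  = begin
          # (branch? s) (allVecs n n)  ≡⟨ #-cong (branch? s) (fits? τ U)
              (λ { {σ} ((inj , good , agree) , closes) → inj , good , agree-after σ agree closes })
              (λ { {σ} (inj , good , agree) → let agree′ , closes = agree-before σ agree in (inj , good , agree′) , closes })
              (allVecs n n) ⟩
          completions τ U              ≡⟨ closed-claim τ U (ℕ.≤-trans (ℕ.≤-trans (ℕ.n≤1+n m) (ℕ.m≤n+m (suc m) k)) k+m<n) ∣U∣≡m
              (λ x x∈U → let x∈F , x≢e = ∈-⇒∈ F e x x∈U in fixes x x∈F x≢e) closed-good ⟩
          closed# m                    ≡⟨ ℕ.*-identityˡ (closed# m) ⟨
          1 * closed# m                ∎
          where
          closed-good : ClosedGood τ U
          closed-good σ inj agree x x∉U =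
            let agree′ , closes = agree-before σ agree
                _ , _ , explored = path σ inj agree′
            in [ id , (λ same → trans (cong p (trans same (cycle σ inj agree′ closes))) eq) ] (explored x (-≡false F e x x∉U))

        extend : ∀ u → U u ≡ true → # (branch? u) (allVecs n n) ≡ extending
        extend u u∈U = by-size m refl
          where
          -- The transposition acts first, which inserts `u` into the closed-up path between its end
          -- and its start: e ↦ u ↦ s.
          τ′ = transpose e u ∘ₚ τ
          u∈F = proj₁ (∈-⇒∈ F e u u∈U)
          u≢e = proj₂ (∈-⇒∈ F e u u∈U)
          τ′e≡u : τ′ ⟨$⟩ʳ e ≡ u
          τ′e≡u = trans (cong (τ ⟨$⟩ʳ_) (transposeˡ e u)) (fixes u u∈F u≢e)
          τ′u≡s : τ′ ⟨$⟩ʳ u ≡ s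
          τ′u≡s = trans (cong (τ ⟨$⟩ʳ_) (transposeʳ e u)) τe≡s
          τ′-≢ : ∀ {x} → x ≢ e → x ≢ u → τ′ ⟨$⟩ʳ x ≡ τ ⟨$⟩ʳ x
          τ′-≢ x≢e x≢u = cong (τ ⟨$⟩ʳ_) (transpose-≢ e u x≢e x≢u)
          ∉F⇒≢ : ∀ {x y} → F x ≡ false → F y ≡ true → x ≢ y
          ∉F⇒≢ x∉F y∈F refl = contradiction (trans (sym y∈F) x∉F) λ ()
          u≢s : u ≢ s
          u≢s u≡s = u≢e (⟨$⟩ʳ-injective τ (trans (fixes u u∈F u≢e) (trans u≡s (sym τe≡s))))
          agree-after′ : ∀ σ → Agree τ F σ → lookup σ e ≡ u → Agree τ′ U σ
          agree-after′ σ agree next x x∉U with -≡false F e x x∉U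
          ... | inj₁ x∉F  = trans (agree x x∉F) (sym (τ′-≢ (∉F⇒≢ x∉F Fe) (∉F⇒≢ x∉F u∈F)))
          ... | inj₂ refl = trans next (sym τ′e≡u)
          agree-before′ : ∀ σ → Agree τ′ U σ → Agree τ F σ × lookup σ e ≡ u
          agree-before′ σ agree =
            (λ x x∉F → trans (agree x (∉⇒∉- F e x x∉F)) (τ′-≢ (∉F⇒≢ x∉F Fe) (∉F⇒≢ x∉F u∈F))) ,
            trans (agree e (∉-- F e)) τ′e≡u
          path′ : OpenPath τ′ U s u (suc k)
          path′ σ inj agree = end′ , first′ , explored′
            where
            before = agree-before′ σ agree
            next = proj₂ before
            old = path σ inj (proj₁ before)
            explored = proj₂ (proj₂ old)
            end′ : iter σ (suc k) s ≡ u
            end′ = trans (cong (lookup σ) (proj₁ old)) next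
            first′ : ∀ j → j < suc k → iter σ (suc j) s ≢ s
            first′ j (s≤s j≤k) with ℕ.m≤n⇒m<n∨m≡n j≤k
            ... | inj₁ j<k  = proj₁ (proj₂ old) j j<k
            ... | inj₂ refl = λ loop → u≢s (trans (sym end′) loop)
            explored′ : ∀ x → U x ≡ false ⊎ x ≡ u → p (cycleLen σ x) ≡ true ⊎ cycleLen σ x ≡ cycleLen σ s
            explored′ x (inj₁ x∉U)  = explored x (-≡false F e x x∉U)
            -- The new end u = σ e lies on the cycle of `e`, so what is known about `e` carries
            -- over.
            explored′ x (inj₂ refl) = subst (λ l → p l ≡ true ⊎ l ≡ cycleLen σ s)
              (trans (sym (cycleLen-lookup σ inj e)) (cong (cycleLen σ) next)) (explored e (inj₂ refl))
          by-size : ∀ m′ → m ≡ m′ → # (branch? u) (allVecs n n) ≡ extended# m′ k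
          by-size zero     eq = contradiction (trans (sym u∈U) (∣∣≡0 U (trans ∣U∣≡m eq) u)) λ ()
          by-size (suc m′) eq = begin
            # (branch? u) (allVecs n n)  ≡⟨ #-cong (branch? u) (fits? τ′ U)
                (λ { {σ} ((inj , good , agree) , next) → inj , good , agree-after′ σ agree next })
                (λ { {σ} (inj , good , agree) → let agree′ , next = agree-before′ σ agree in (inj , good , agree′) , next })
                (allVecs n n) ⟩
            completions τ′ U             ≡⟨ open-claim eq (suc k) τ′ U s u (subst (_≤ n) (trans (cong (λ l → k + suc l) eq) (ℕ.+-suc k (suc m′))) k+m<n)
                (trans ∣U∣≡m eq) u∈U τ′u≡s (λ x x∈U x≢u → let x∈F , x≢e = ∈-⇒∈ F e x x∈U in trans (τ′-≢ x≢e x≢u) (fixes x x∈F x≢e)) path′ ⟩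
            open# m′ (suc k)              ∎

        branch : ∀ y → # (branch? y) (allVecs n n) ≡ 𝟙 (does (s ≟ y)) * closing + 𝟙 (U y) * extending
        branch y with s ≟ y | U y in eq
        ... | yes refl | false = trans close (sym (trans (ℕ.+-identityʳ (closing + 0)) (ℕ.+-identityʳ closing)))
        ... | yes refl | true  = let s∈F , s≢e = ∈-⇒∈ F e s eq in
          contradiction (⟨$⟩ʳ-injective τ (trans (fixes s s∈F s≢e) (sym τe≡s))) s≢e
        ... | no _     | true  = trans (extend y eq) (sym (ℕ.+-identityʳ extending))
        ... | no s≢y   | false = #-none (branch? y) (λ { {σ} ((inj , _ , agree) , next) → absurd σ inj agree next }) (allVecs n n)
          where
          absurd : ∀ σ → Injective σ → Agree τ F σ → lookup σ e ≢ y
          -- Let x be the preimage of y under `τ`. If x = e, then y = s. If x is untouched, then y =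
          -- x is untouched. Otherwise σ x = y = σ e with x ≠ e, against injectivity.
          absurd σ inj agree next with F (τ ⟨$⟩ˡ y) in x∈?F | (τ ⟨$⟩ˡ y) ≟ e
          ... | _     | yes x≡e = s≢y (trans (sym τe≡s) (trans (cong (τ ⟨$⟩ʳ_) (sym x≡e)) (inverseʳ τ)))
          ... | true  | no x≢e = contradiction (trans (sym (∈⇒∈- F e _ x∈?F x≢e)) (trans (cong U x≡y) eq)) λ ()
            where x≡y = trans (sym (fixes _ x∈?F x≢e)) (inverseʳ τ)
          ... | false | no x≢e = x≢e (inj _ _ (trans (agree _ x∈?F) (trans (inverseʳ τ) (sym next))))

    mutual
      completions-closed : (m : ℕ) → ClosedClaim n m
      completions-closed zero    τ U m≤n size fixes good = completions-full τ U (∣∣≡0 U size) good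
      completions-closed (suc m) = start-path (completions-open m)

      completions-open : (m : ℕ) → OpenClaim n m
      completions-open zero    = continue-path (completions-closed zero) λ ()
      completions-open (suc m) = continue-path (completions-closed (suc m)) λ { refl → completions-open m }

    private
      allᵇ-tabulate⁻ : {A : Set} (f : A → Bool) (g : Fin n → A) → allᵇ f (List.tabulate g) ≡ true → ∀ i → f (g i) ≡ true
      allᵇ-tabulate⁻ {n = suc n} f g eq i with f (g zero) in eq₀
      allᵇ-tabulate⁻ {n = suc n} f g eq zero    | true = eq₀
      allᵇ-tabulate⁻ {n = suc n} f g eq (suc i) | true = allᵇ-tabulate⁻ f (g ∘ suc) eq i

      allᵇ-tabulate⁺ : {A : Set} (f : A → Bool) (g : Fin n → A) → (∀ i → f (g i) ≡ true) → allᵇ f (List.tabulate g) ≡ true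
      allᵇ-tabulate⁺ {n = zero}  f g all = refl
      allᵇ-tabulate⁺ {n = suc n} f g all = cong₂ _∧_ (all zero) (allᵇ-tabulate⁺ f (g ∘ suc) (all ∘ suc))

      entry⁻ : {i j k l : Fin n} → not ⌊ i ≟ j ⌋ ∨ ⌊ k ≟ l ⌋ ≡ true → i ≡ j → k ≡ l
      entry⁻ {i = i} {j} {k} {l} eq i≡j with i ≟ j | k ≟ l
      ... | _      | yes k≡l = k≡l
      ... | no i≢j | no _    = contradiction i≡j i≢j

      entry⁺ : {i j k l : Fin n} → (i ≡ j → k ≡ l) → not ⌊ i ≟ j ⌋ ∨ ⌊ k ≟ l ⌋ ≡ true
      entry⁺ {i = i} {j} {k} {l} imp with i ≟ j | k ≟ l
      ... | no _    | _      = refl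
      ... | yes _   | yes _  = refl
      ... | yes i≡j | no k≢l = contradiction (imp i≡j) k≢l

    isInjective⁻ : (σ : Vec (Fin n) n) → isInjective σ ≡ true → Injective σ
    isInjective⁻ σ eq i j = entry⁻ (allᵇ-tabulate⁻ _ id (allᵇ-tabulate⁻ _ id eq i) j)

    isInjective⁺ : (σ : Vec (Fin n) n) → Injective σ → isInjective σ ≡ true
    isInjective⁺ σ inj = allᵇ-tabulate⁺ _ id λ i → allᵇ-tabulate⁺ _ id λ j → entry⁺ (inj i j)

    good : Vec (Fin n) n → Bool
    good {n} σ = allᵇ (λ i → p (cycleLen σ i)) (allFin n)

    -- The exploration starts from the identity with all points untouched; then `Agree` and
    -- `ClosedGood` are vacuous.
    #good : (n : ℕ) → length (filterᵇ good (perms n)) ≡ closed# n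
    #good n = begin
      length (filterᵇ good (perms n))     ≡⟨ cong length (filterᵇ-filterᵇ good isInjective (allVecs n n)) ⟩
      # (T? ∘ valid) (allVecs n n)        ≡⟨ #-cong {A = Vec (Fin n) n} (T? ∘ valid) (fits? idₚ everything) (λ {σ} → to σ) (λ {σ} → from σ) (allVecs n n) ⟩
      completions {n} idₚ everything      ≡⟨ completions-closed n (idₚ {n}) (everything {n}) ℕ.≤-refl (size n) (λ _ _ → refl) (λ _ _ _ _ ()) ⟩
      closed# n                           ∎
      where
      open ≡-Reasoning
      valid : Vec (Fin n) n → Bool
      valid σ = isInjective σ ∧ good σ
      everything : {m : ℕ} → Fin m → Bool
      everything _ = true
      size : ∀ m → ∣ everything {m} ∣ ≡ m
      size zero    = refl
      size (suc m) = cong suc (size m)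
      to : ∀ σ → T (valid σ) → Fits idₚ everything σ
      to σ t with isInjective σ in i | good σ in g
      ... | true | true = isInjective⁻ σ i , allᵇ-tabulate⁻ _ id g , λ _ ()
      from : ∀ σ → Fits idₚ everything σ → T (valid σ)
      from σ (inj , goodσ , _) = Equivalence.from Bool.T-≡ (cong₂ _∧_ (isInjective⁺ σ inj) (allᵇ-tabulate⁺ _ id goodσ))

-- Rational arithmetic: naturals, reciprocals, absolute values

module Analysis where

  open Counting using (𝟙; module Exploration)
  import Data.Integer as ℤ
  import Data.Integer.Properties as ℤ
  open import Data.Nat.Induction using (<-rec)
  open import Data.Rational using (ℚ; mkℚ; 0ℚ; 1ℚ; _+_; _*_; _-_; -_; _/_; _≤_; _<_; ∣_∣; toℚᵘ; nonNegative)
  open import Data.Rational.Properties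
  import Data.Rational.Unnormalised as ℚᵘ
  import Data.Rational.Unnormalised.Properties as ℚᵘ
  open import Level using (0ℓ)
  open import Tactic.RingSolver using (solve-∀)
  open import Tactic.RingSolver.Core.AlmostCommutativeRing using (AlmostCommutativeRing; fromCommutativeRing)

  ℚ-ring : AlmostCommutativeRing 0ℓ 0ℓ
  ℚ-ring = fromCommutativeRing +-*-commutativeRing (λ x → dec⇒maybe (0ℚ ≟ x))

  ι : ℕ → ℚ
  ι n = ℤ.+ n / 1

  -- Fraction identities are checked on unnormalised rationals, where no common divisors have to be
  -- cancelled.
  toℚᵘ-/ : ∀ z d {{_ : ℕ.NonZero d}} → toℚᵘ (z / d) ℚᵘ.≃ z ℚᵘ./ d
  toℚᵘ-/ z (suc d) = toℚᵘ-fromℚᵘ (ℚᵘ.mkℚᵘ z d)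

  /-+ : ∀ z w → z / 1 + w / 1 ≡ (z ℤ.+ w) / 1
  /-+ z w = toℚᵘ-injective (begin
    toℚᵘ (z / 1 + w / 1)              ≈⟨ toℚᵘ-homo-+ (z / 1) (w / 1) ⟩
    toℚᵘ (z / 1) ℚᵘ.+ toℚᵘ (w / 1)    ≈⟨ ℚᵘ.+-cong (toℚᵘ-/ z 1) (toℚᵘ-/ w 1) ⟩
    z ℚᵘ./ 1 ℚᵘ.+ w ℚᵘ./ 1            ≈⟨ ℚᵘ.*≡* (cong (ℤ._* ℤ.+ 1) (cong₂ ℤ._+_ (ℤ.*-identityʳ z) (ℤ.*-identityʳ w))) ⟩
    (z ℤ.+ w) ℚᵘ./ 1                  ≈⟨ toℚᵘ-/ (z ℤ.+ w) 1 ⟨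
    toℚᵘ ((z ℤ.+ w) / 1)              ∎)
    where open ℚᵘ.≃-Reasoning

  /-* : ∀ z w d {{_ : ℕ.NonZero d}} → z / 1 * (w / d) ≡ (z ℤ.* w) / d
  /-* z w (suc d) = toℚᵘ-injective (begin
    toℚᵘ (z / 1 * (w / suc d))              ≈⟨ toℚᵘ-homo-* (z / 1) (w / suc d) ⟩
    toℚᵘ (z / 1) ℚᵘ.* toℚᵘ (w / suc d)      ≈⟨ ℚᵘ.*-cong (toℚᵘ-/ z 1) (toℚᵘ-/ w (suc d)) ⟩
    z ℚᵘ./ 1 ℚᵘ.* (w ℚᵘ./ suc d)            ≈⟨ ℚᵘ.*≡* (cong (λ e → z ℤ.* w ℤ.* ℤ.+ suc e) (sym (ℕ.+-identityʳ d))) ⟩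
    (z ℤ.* w) ℚᵘ./ suc d                    ≈⟨ toℚᵘ-/ (z ℤ.* w) (suc d) ⟨
    toℚᵘ ((z ℤ.* w) / suc d)                ∎)
    where open ℚᵘ.≃-Reasoning

  ι-+ : ∀ m n → ι (m ℕ.+ n) ≡ ι m + ι n
  ι-+ m n = sym (/-+ (ℤ.+ m) (ℤ.+ n))

  ι-suc : ∀ n → ι (suc n) ≡ 1ℚ + ι n
  ι-suc n = ι-+ 1 n

  ι-* : ∀ m n → ι (m ℕ.* n) ≡ ι m * ι n
  ι-* m n = trans (cong (_/ 1) (ℤ.pos-* m n)) (sym (/-* (ℤ.+ m) (ℤ.+ n) 1))

  /-ι : ∀ m d {{_ : ℕ.NonZero d}} → ℤ.+ m / d ≡ ι m * (ℤ.+ 1 / d)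
  /-ι m d = trans (cong (_/ d) (sym (ℤ.*-identityʳ (ℤ.+ m)))) (sym (/-* (ℤ.+ m) (ℤ.+ 1) d))

  ι-*-recip : ∀ d {{_ : ℕ.NonZero d}} → ι d * (ℤ.+ 1 / d) ≡ 1ℚ
  ι-*-recip (suc d) = trans (sym (/-ι (suc d) (suc d))) (toℚᵘ-injective
    (ℚᵘ.≃-trans (toℚᵘ-/ (ℤ.+ suc d) (suc d)) (ℚᵘ.*≡* (ℤ.*-comm (ℤ.+ suc d) (ℤ.+ 1)))))

  0≤ι : ∀ n → 0ℚ ≤ ι n
  0≤ι n = nonNegative⁻¹ (ι n) {{normalize-nonNeg n 1}}

  ι-mono-≤ : ∀ {m n} → m ℕ.≤ n → ι m ≤ ι n
  ι-mono-≤ {m} {n} m≤n = begin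
    ι m                    ≡⟨ +-identityʳ (ι m) ⟨
    ι m + 0ℚ               ≤⟨ +-monoʳ-≤ (ι m) (0≤ι (n ℕ.∸ m)) ⟩
    ι m + ι (n ℕ.∸ m)      ≡⟨ ι-+ m (n ℕ.∸ m) ⟨
    ι (m ℕ.+ (n ℕ.∸ m))    ≡⟨ cong ι (ℕ.m+[n∸m]≡n m≤n) ⟩
    ι n                    ∎
    where open ≤-Reasoning

  1/! : ℕ → ℚ
  1/! n = (ℤ.+ 1 / (n !)) {{n ℕ.!≢0}}

  inv-suc : ∀ n → ι (suc n) * inv (suc n) ≡ 1ℚ
  inv-suc n = ι-*-recip (suc n)

  0≤inv : ∀ n → 0ℚ ≤ inv n
  0≤inv zero    = ≤-refl
  0≤inv (suc n) = nonNegative⁻¹ (inv (suc n)) {{normalize-nonNeg 1 (suc n)}}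

  1/!-suc : ∀ n → ι (suc n) * 1/! (suc n) ≡ 1/! n
  1/!-suc n = begin
    s * 1/! (suc n)                             ≡⟨ *-identityʳ _ ⟨
    s * 1/! (suc n) * 1ℚ                        ≡⟨ cong (s * 1/! (suc n) *_) (ι-*-recip (n !) {{n ℕ.!≢0}}) ⟨
    s * 1/! (suc n) * (ι (n !) * 1/! n)         ≡⟨ rearrange s (1/! (suc n)) (ι (n !)) (1/! n) ⟩
    s * ι (n !) * 1/! (suc n) * 1/! n           ≡⟨ cong (λ x → x * 1/! (suc n) * 1/! n) (ι-* (suc n) (n !)) ⟨
    ι (suc n !) * 1/! (suc n) * 1/! n           ≡⟨ cong (_* 1/! n) (ι-*-recip (suc n !) {{suc n ℕ.!≢0}}) ⟩
    1ℚ * 1/! n                                  ≡⟨ *-identityˡ _ ⟩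
    1/! n                                       ∎
    where
    open ≡-Reasoning
    s = ι (suc n)
    rearrange : ∀ a b c d → a * b * (c * d) ≡ a * c * b * d
    rearrange = solve-∀ ℚ-ring

  *-monoˡ : ∀ {x y z} → 0ℚ ≤ z → x ≤ y → z * x ≤ z * y
  *-monoˡ {z = z} 0≤z = *-monoˡ-≤-nonNeg z {{nonNegative 0≤z}}

  *-monoʳ : ∀ {x y z} → 0ℚ ≤ z → x ≤ y → x * z ≤ y * z
  *-monoʳ {z = z} 0≤z = *-monoʳ-≤-nonNeg z {{nonNegative 0≤z}}

  0≤* : ∀ {x y} → 0ℚ ≤ x → 0ℚ ≤ y → 0ℚ ≤ x * y
  0≤* {x} {y} 0≤x 0≤y = subst (_≤ x * y) (*-zeroʳ x) (*-monoˡ 0≤x 0≤y)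

  inv-*-cancel : ∀ n {x y} → ι (suc n) * x ≡ y → x ≡ inv (suc n) * y
  inv-*-cancel n {x} refl = begin
    x                              ≡⟨ *-identityˡ x ⟨
    1ℚ * x                         ≡⟨ cong (_* x) (inv-suc n) ⟨
    ι (suc n) * inv (suc n) * x    ≡⟨ rearrange (ι (suc n)) (inv (suc n)) x ⟩
    inv (suc n) * (ι (suc n) * x)  ∎
    where
    open ≡-Reasoning
    rearrange : ∀ a b c → a * b * c ≡ b * (a * c)
    rearrange = solve-∀ ℚ-ring

  ι-cancel : ∀ n {x y} → ι (suc n) * x ≡ ι (suc n) * y → x ≡ y
  ι-cancel n eq = trans (inv-*-cancel n eq) (sym (inv-*-cancel n refl))

  ι-cancel-≤ : ∀ n {x y} → ι (suc n) * x ≤ ι (suc n) * y → x ≤ y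
  ι-cancel-≤ n le = subst₂ _≤_ (sym (inv-*-cancel n refl)) (sym (inv-*-cancel n refl)) (*-monoˡ (0≤inv (suc n)) le)

  inv-anti : ∀ {m n} → m ℕ.≤ n → inv (suc n) ≤ inv (suc m)
  inv-anti {m} {n} m≤n = ι-cancel-≤ m (begin
    ι (suc m) * inv (suc n)   ≤⟨ *-monoʳ (0≤inv (suc n)) (ι-mono-≤ (ℕ.s≤s m≤n)) ⟩
    ι (suc n) * inv (suc n)   ≡⟨ inv-suc n ⟩
    1ℚ                        ≡⟨ inv-suc m ⟨
    ι (suc m) * inv (suc m)   ∎)
    where open ≤-Reasoning

  -- For r + 2 ≤ k ≤ 2r + 1 this is the value of a_k, with k = m + 2.
  inv-difference : ∀ m → inv (suc (suc m)) - inv (suc m) ≡ - (inv (suc m) * inv (suc (suc m)))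
  inv-difference m = begin
    y - x                                ≡⟨ cong₂ _-_ (*-identityˡ y) (*-identityˡ x) ⟨
    1ℚ * y - 1ℚ * x                      ≡⟨ cong₂ (λ u v → u * y - v * x) (inv-suc m) (inv-suc (suc m)) ⟨
    ι (suc m) * x * y - ι (suc (suc m)) * y * x   ≡⟨ cong (λ u → ι (suc m) * x * y - u * y * x) (ι-suc (suc m)) ⟩
    ι (suc m) * x * y - (1ℚ + ι (suc m)) * y * x  ≡⟨ simplify (ι (suc m)) x y ⟩
    - (x * y)                            ∎
    where
    open ≡-Reasoning
    x = inv (suc m)
    y = inv (suc (suc m))
    simplify : ∀ a x y → a * x * y - (1ℚ + a) * y * x ≡ - (x * y)
    simplify = solve-∀ ℚ-ring

  p≤∣p∣ : ∀ p → p ≤ ∣ p ∣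
  p≤∣p∣ p with ≤-total 0ℚ p
  ... | inj₁ 0≤p = ≤-reflexive (sym (0≤p⇒∣p∣≡p 0≤p))
  ... | inj₂ p≤0 = ≤-trans p≤0 (0≤∣p∣ p)

  ∣-∣≤⇒≤+ : ∀ x y z → ∣ x - y ∣ ≤ z → x ≤ y + z
  ∣-∣≤⇒≤+ x y z le = subst (_≤ y + z) (cancel x y) (+-monoʳ-≤ y (≤-trans (p≤∣p∣ (x - y)) le))
    where
    cancel : ∀ x y → y + (x - y) ≡ x
    cancel = solve-∀ ℚ-ring

  ∣-∣≤⇒-≤ : ∀ x y z → ∣ x - y ∣ ≤ z → y - z ≤ x
  ∣-∣≤⇒-≤ x y z le = subst (y - z ≤_) (cancel x z) (+-monoˡ-≤ (- z) (∣-∣≤⇒≤+ y x z (subst (_≤ z) swap le)))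
    where
    cancel : ∀ x z → x + z + - z ≡ x
    cancel = solve-∀ ℚ-ring
    negate : ∀ x y → - (x - y) ≡ y - x
    negate = solve-∀ ℚ-ring
    swap : ∣ x - y ∣ ≡ ∣ y - x ∣
    swap = trans (sym (∣-p∣≡∣p∣ (x - y))) (cong ∣_∣ (negate x y))

  archimedean : ∀ ε → 0ℚ < ε → ∀ m → ∃[ N ] ι m ≤ ε * ι N
  archimedean ε@(mkℚ (ℤ.+ zero)    d _) 0<ε m = contradiction (drop-*<* 0<ε) λ { (ℤ.+<+ ()) }
  archimedean ε@(mkℚ ℤ.-[1+ p ] d _) 0<ε m = contradiction (drop-*<* 0<ε) λ ()
  -- With ε = (p + 1)/(d + 1), the witness N = (d + 1) m gives ε N = (p + 1) m.
  archimedean ε@(mkℚ (ℤ.+ suc p)   d _) 0<ε m = suc d ℕ.* m , (begin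
    ι m                                              ≤⟨ ι-mono-≤ (ℕ.m≤n*m m (suc p)) ⟩
    ι (suc p ℕ.* m)                                  ≡⟨ ι-* (suc p) m ⟩
    ι (suc p) * ι m                                  ≡⟨ cong (_* ι m) (*-identityʳ (ι (suc p))) ⟨
    ι (suc p) * 1ℚ * ι m                             ≡⟨ cong (λ x → ι (suc p) * x * ι m) (inv-suc d) ⟨
    ι (suc p) * (ι (suc d) * inv (suc d)) * ι m      ≡⟨ rearrange (ι (suc p)) (ι (suc d)) (inv (suc d)) (ι m) ⟩
    ι (suc p) * inv (suc d) * (ι (suc d) * ι m)      ≡⟨ cong₂ _*_ (trans (sym (/-ι (suc p) (suc d))) (↥p/↧p≡p ε)) (sym (ι-* (suc d) m)) ⟩
    ε * ι (suc d ℕ.* m)                              ∎)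
    where
    open ≤-Reasoning
    rearrange : ∀ a b c d → a * (b * c) * d ≡ a * c * (b * d)
    rearrange = solve-∀ ℚ-ring

  -- Finite sums and operations on coefficient sequences

  ∑ : ℕ → (ℕ → ℚ) → ℚ
  ∑ zero    f = 0ℚ
  ∑ (suc n) f = ∑ n f + f n

  -- On coefficient sequences, `prefix`, `shift i` and `win r` are multiplication by 1/(1 - z), by
  -- z^i and by z + ... + z^r = z P′(z).
  prefix : (ℕ → ℚ) → ℕ → ℚ
  prefix f k = ∑ (suc k) f

  shift : ℕ → (ℕ → ℚ) → ℕ → ℚ
  shift zero    f k       = f k
  shift (suc i) f zero    = 0ℚ
  shift (suc i) f (suc k) = shift i f k

  win : ℕ → (ℕ → ℚ) → ℕ → ℚ
  win r f k = ∑ r λ i → shift (suc i) f k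

  ∑-cong : ∀ n {f g} → (∀ i → i ℕ.< n → f i ≡ g i) → ∑ n f ≡ ∑ n g
  ∑-cong zero    eq = refl
  ∑-cong (suc n) eq = cong₂ _+_ (∑-cong n λ i i<n → eq i (ℕ.m≤n⇒m≤1+n i<n)) (eq n ℕ.≤-refl)

  ∑-cong-≗ : ∀ n {f g} → f ≗ g → ∑ n f ≡ ∑ n g
  ∑-cong-≗ n eq = ∑-cong n λ i _ → eq i

  ∑-zero : ∀ n {f} → (∀ i → i ℕ.< n → f i ≡ 0ℚ) → ∑ n f ≡ 0ℚ
  ∑-zero zero    eq = refl
  ∑-zero (suc n) eq = cong₂ _+_ (∑-zero n λ i i<n → eq i (ℕ.m≤n⇒m≤1+n i<n)) (eq n ℕ.≤-refl)

  ∑-+ : ∀ n f g → ∑ n (λ i → f i + g i) ≡ ∑ n f + ∑ n g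
  ∑-+ zero    f g = refl
  ∑-+ (suc n) f g = trans (cong (_+ (f n + g n)) (∑-+ n f g)) (swap (∑ n f) (∑ n g) (f n) (g n))
    where
    swap : ∀ a b c d → a + b + (c + d) ≡ a + c + (b + d)
    swap = solve-∀ ℚ-ring

  ∑-*ˡ : ∀ n c f → ∑ n (λ i → c * f i) ≡ c * ∑ n f
  ∑-*ˡ zero    c f = sym (*-zeroʳ c)
  ∑-*ˡ (suc n) c f = trans (cong (_+ c * f n) (∑-*ˡ n c f)) (sym (*-distribˡ-+ c (∑ n f) (f n)))

  ∑-swap : ∀ m n (f : ℕ → ℕ → ℚ) → ∑ m (λ i → ∑ n (f i)) ≡ ∑ n (λ j → ∑ m (λ i → f i j))
  ∑-swap zero    n f = sym (∑-zero n λ _ _ → refl)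
  ∑-swap (suc m) n f = trans (cong (_+ ∑ n (f m)) (∑-swap m n f)) (sym (∑-+ n (λ j → ∑ m λ i → f i j) (f m)))

  ∑-head : ∀ n f → ∑ (suc n) f ≡ f 0 + ∑ n (f ∘ suc)
  ∑-head zero    f = +-comm 0ℚ (f 0)
  ∑-head (suc n) f = trans (cong (_+ f (suc n)) (∑-head n f)) (+-assoc (f 0) (∑ n (f ∘ suc)) (f (suc n)))

  ∑-split : ∀ m n f → ∑ (m ℕ.+ n) f ≡ ∑ m f + ∑ n (λ i → f (m ℕ.+ i))
  ∑-split m zero    f = trans (cong (λ k → ∑ k f) (ℕ.+-identityʳ m)) (sym (+-identityʳ (∑ m f)))
  ∑-split m (suc n) f = begin
    ∑ (m ℕ.+ suc n) f                                         ≡⟨ cong (λ k → ∑ k f) (ℕ.+-suc m n) ⟩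
    ∑ (m ℕ.+ n) f + f (m ℕ.+ n)                               ≡⟨ cong (_+ f (m ℕ.+ n)) (∑-split m n f) ⟩
    ∑ m f + ∑ n (λ i → f (m ℕ.+ i)) + f (m ℕ.+ n)             ≡⟨ +-assoc (∑ m f) _ _ ⟩
    ∑ m f + ∑ (suc n) (λ i → f (m ℕ.+ i))                     ∎
    where open ≡-Reasoning

  ∑-mono : ∀ n {f g} → (∀ i → i ℕ.< n → f i ≤ g i) → ∑ n f ≤ ∑ n g
  ∑-mono zero    le = ≤-refl
  ∑-mono (suc n) le = +-mono-≤ (∑-mono n λ i i<n → le i (ℕ.m≤n⇒m≤1+n i<n)) (le n ℕ.≤-refl)

  0≤∑ : ∀ n {f} → (∀ i → i ℕ.< n → 0ℚ ≤ f i) → 0ℚ ≤ ∑ n f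
  0≤∑ n {f} le = subst (_≤ ∑ n f) (∑-zero n λ _ _ → refl) (∑-mono n le)

  ∑-≤-const : ∀ n {f} c → (∀ i → i ℕ.< n → f i ≤ c) → ∑ n f ≤ ι n * c
  ∑-≤-const zero    c le = ≤-reflexive (sym (*-zeroˡ c))
  ∑-≤-const (suc n) {f} c le = begin
    ∑ n f + f n      ≤⟨ +-mono-≤ (∑-≤-const n c λ i i<n → le i (ℕ.m≤n⇒m≤1+n i<n)) (le n ℕ.≤-refl) ⟩
    ι n * c + c      ≡⟨ collect (ι n) c ⟩
    (1ℚ + ι n) * c   ≡⟨ cong (_* c) (ι-suc n) ⟨
    ι (suc n) * c    ∎
    where
    open ≤-Reasoning
    collect : ∀ a c → a * c + c ≡ (1ℚ + a) * c
    collect = solve-∀ ℚ-ring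

  ∑-extend : ∀ {m n} f → m ℕ.≤ n → (∀ i → m ℕ.≤ i → 0ℚ ≤ f i) → ∑ m f ≤ ∑ n f
  ∑-extend {m} {n} f m≤n pos = begin
    ∑ m f                                           ≡⟨ +-identityʳ (∑ m f) ⟨
    ∑ m f + 0ℚ                                      ≤⟨ +-monoʳ-≤ (∑ m f) (0≤∑ (n ℕ.∸ m) λ i _ → pos (m ℕ.+ i) (ℕ.m≤m+n m i)) ⟩
    ∑ m f + ∑ (n ℕ.∸ m) (λ i → f (m ℕ.+ i))         ≡⟨ ∑-split m (n ℕ.∸ m) f ⟨
    ∑ (m ℕ.+ (n ℕ.∸ m)) f                           ≡⟨ cong (λ k → ∑ k f) (ℕ.m+[n∸m]≡n m≤n) ⟩
    ∑ n f                                           ∎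
    where open ≤-Reasoning

  ∑-vanish : ∀ {m n} f → m ℕ.≤ n → (∀ i → m ℕ.≤ i → f i ≡ 0ℚ) → ∑ n f ≡ ∑ m f
  ∑-vanish {m} {n} f m≤n zeros = begin
    ∑ n f                                     ≡⟨ cong (λ k → ∑ k f) (ℕ.m+[n∸m]≡n m≤n) ⟨
    ∑ (m ℕ.+ (n ℕ.∸ m)) f                     ≡⟨ ∑-split m (n ℕ.∸ m) f ⟩
    ∑ m f + ∑ (n ℕ.∸ m) (λ i → f (m ℕ.+ i))   ≡⟨ cong (∑ m f +_) (∑-zero (n ℕ.∸ m) λ i _ → zeros (m ℕ.+ i) (ℕ.m≤m+n m i)) ⟩
    ∑ m f + 0ℚ                                ≡⟨ +-identityʳ (∑ m f) ⟩
    ∑ m f                                     ∎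
    where open ≡-Reasoning

  ∣∑∣≤∑∣∣ : ∀ n f → ∣ ∑ n f ∣ ≤ ∑ n (λ i → ∣ f i ∣)
  ∣∑∣≤∑∣∣ zero    f = ≤-refl
  ∣∑∣≤∑∣∣ (suc n) f = ≤-trans (∣p+q∣≤∣p∣+∣q∣ (∑ n f) (f n)) (+-monoˡ-≤ ∣ f n ∣ (∣∑∣≤∑∣∣ n f))

  shift-cong : ∀ i {f g} k → (∀ j → j ℕ.≤ k → f j ≡ g j) → shift i f k ≡ shift i g k
  shift-cong zero    k       eq = eq k ℕ.≤-refl
  shift-cong (suc i) zero    eq = refl
  shift-cong (suc i) (suc k) eq = shift-cong i k λ j j≤k → eq j (ℕ.m≤n⇒m≤1+n j≤k)

  shift-vanish : ∀ i f k → k ℕ.< i → shift i f k ≡ 0ℚ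
  shift-vanish (suc i) f zero    _         = refl
  shift-vanish (suc i) f (suc k) (s≤s k<i) = shift-vanish i f k k<i

  shift-+ : ∀ i f k → shift i f (i ℕ.+ k) ≡ f k
  shift-+ zero    f k = refl
  shift-+ (suc i) f k = shift-+ i f k

  shift-linear : ∀ i n (w : ℕ → ℚ) (g : ℕ → ℕ → ℚ) k →
                 shift i (λ l → ∑ n λ j → w j * g j l) k ≡ ∑ n (λ j → w j * shift i (g j) k)
  shift-linear zero    n w g k       = refl
  shift-linear (suc i) n w g zero    = sym (∑-zero n λ j _ → *-zeroʳ (w j))
  shift-linear (suc i) n w g (suc k) = shift-linear i n w g k

  shift-∑ : ∀ i n (g : ℕ → ℕ → ℚ) k → shift i (λ l → ∑ n λ j → g j l) k ≡ ∑ n (λ j → shift i (g j) k)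
  shift-∑ zero    n g k       = refl
  shift-∑ (suc i) n g zero    = sym (∑-zero n λ j _ → refl)
  shift-∑ (suc i) n g (suc k) = shift-∑ i n g k

  shift-*ˡ : ∀ i c f k → shift i (λ l → c * f l) k ≡ c * shift i f k
  shift-*ˡ zero    c f k       = refl
  shift-*ˡ (suc i) c f zero    = sym (*-zeroʳ c)
  shift-*ˡ (suc i) c f (suc k) = shift-*ˡ i c f k

  shift-shift : ∀ i j f k → shift i (shift j f) k ≡ shift (i ℕ.+ j) f k
  shift-shift zero    j f k       = refl
  shift-shift (suc i) j f zero    = refl
  shift-shift (suc i) j f (suc k) = shift-shift i j f k

  shift-comm : ∀ i j f k → shift i (shift j f) k ≡ shift j (shift i f) k
  shift-comm i j f k = trans (shift-shift i j f k)
    (trans (cong (λ l → shift l f k) (ℕ.+-comm i j)) (sym (shift-shift j i f k)))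

  shift-∣∣ : ∀ i f k → ∣ shift i f k ∣ ≡ shift i (∣_∣ ∘ f) k
  shift-∣∣ zero    f k       = refl
  shift-∣∣ (suc i) f zero    = refl
  shift-∣∣ (suc i) f (suc k) = shift-∣∣ i f k

  -- z^i multiplied by the derivation z d/dz: on coefficients, k = i + (k - i).
  shift-derivation : ∀ i f k → ι k * shift i f k ≡ ι i * shift i f k + shift i (λ l → ι l * f l) k
  shift-derivation zero    f k    = sym (trans (cong (_+ ι k * f k) (*-zeroˡ (f k))) (+-identityˡ _))
  shift-derivation (suc i) f zero = sym (trans (+-identityʳ _) (trans (*-zeroʳ (ι (suc i))) (sym (*-zeroʳ 0ℚ))))
  shift-derivation (suc i) f (suc k) = begin
    ι (suc k) * s              ≡⟨ cong (_* s) (ι-suc k) ⟩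
    (1ℚ + ι k) * s             ≡⟨ expand (ι k) s ⟩
    s + ι k * s                ≡⟨ cong (s +_) (shift-derivation i f k) ⟩
    s + (ι i * s + t)          ≡⟨ collect (ι i) s t ⟩
    (1ℚ + ι i) * s + t         ≡⟨ cong (λ x → x * s + t) (ι-suc i) ⟨
    ι (suc i) * s + t          ∎
    where
    open ≡-Reasoning
    s = shift i f k
    t = shift i (λ l → ι l * f l) k
    expand : ∀ a s → (1ℚ + a) * s ≡ s + a * s
    expand = solve-∀ ℚ-ring
    collect : ∀ a s t → s + (a * s + t) ≡ (1ℚ + a) * s + t
    collect = solve-∀ ℚ-ring

  ∑-shift : ∀ i n f → ∑ (i ℕ.+ n) (shift i f) ≡ ∑ n f
  ∑-shift i n f = begin
    ∑ (i ℕ.+ n) (shift i f)                           ≡⟨ ∑-split i n (shift i f) ⟩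
    ∑ i (shift i f) + ∑ n (λ k → shift i f (i ℕ.+ k)) ≡⟨ cong₂ _+_ (∑-zero i (shift-vanish i f)) (∑-cong-≗ n (shift-+ i f)) ⟩
    0ℚ + ∑ n f                                        ≡⟨ +-identityˡ (∑ n f) ⟩
    ∑ n f                                             ∎
    where open ≡-Reasoning

  win-cong : ∀ r {f g} k → (∀ j → j ℕ.< k → f j ≡ g j) → win r f k ≡ win r g k
  win-cong r zero    eq = refl
  win-cong r (suc k) eq = ∑-cong-≗ r λ i → shift-cong i k λ j j≤k → eq j (s≤s j≤k)

  -- This is 1/(1 - z) = (1 + ... + z^{r-1}) + z^r/(1 - z). The window sits at k + 1 because `win`
  -- excludes its own index.
  prefix-window : ∀ r f k → prefix f k ≡ win r f (suc k) + shift r (prefix f) k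
  prefix-window zero    f k = sym (+-identityˡ (prefix f k))
  prefix-window (suc r) f k = trans (prefix-window r f k)
    (trans (cong (win r f (suc k) +_) (last r k)) (sym (+-assoc (win r f (suc k)) (shift r f k) _)))
    where
    last : ∀ r k → shift r (prefix f) k ≡ shift r f k + shift (suc r) (prefix f) k
    last zero    zero    = +-comm 0ℚ (f 0)
    last zero    (suc k) = +-comm (prefix f k) (f (suc k))
    last (suc r) zero    = refl
    last (suc r) (suc k) = last r k

  shift-mono : ∀ i {f g} k → (∀ j → i ℕ.+ j ≡ k → f j ≤ g j) → shift i f k ≤ shift i g k
  shift-mono zero    k       le = le k refl
  shift-mono (suc i) zero    le = ≤-refl
  shift-mono (suc i) (suc k) le = shift-mono i k λ j eq → le j (cong suc eq)

  shift-≤ : ∀ i {f c} k → 0ℚ ≤ c → (∀ j → i ℕ.+ j ≡ k → f j ≤ c) → shift i f k ≤ c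
  shift-≤ zero    k       0≤c le = le k refl
  shift-≤ (suc i) zero    0≤c le = 0≤c
  shift-≤ (suc i) (suc k) 0≤c le = shift-≤ i k 0≤c λ j eq → le j (cong suc eq)

  shift-zero : ∀ i {f} k → (∀ j → i ℕ.+ j ≡ k → f j ≡ 0ℚ) → shift i f k ≡ 0ℚ
  shift-zero zero    k       eq = eq k refl
  shift-zero (suc i) zero    eq = refl
  shift-zero (suc i) (suc k) eq = shift-zero i k λ j i+j≡k → eq j (cong suc i+j≡k)

  module _ (r : ℕ) {f : ℕ → ℚ} (k : ℕ) where

    private
      InWindow : ℕ → Set
      InWindow j = j ℕ.< k × k ℕ.≤ r ℕ.+ j

      in-window : ∀ {i j} → i ℕ.< r → suc i ℕ.+ j ≡ k → InWindow j
      in-window {i} {j} i<r refl = s≤s (ℕ.m≤n+m j i) , ℕ.+-monoˡ-≤ j i<r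

    win-mono : ∀ {g} → (∀ j → InWindow j → f j ≤ g j) → win r f k ≤ win r g k
    win-mono le = ∑-mono r λ i i<r → shift-mono (suc i) k λ j eq → le j (in-window i<r eq)

    -- Nonnegativity of c covers the positions before index 0, where `shift` puts 0.
    win-≤ : ∀ {c} → 0ℚ ≤ c → (∀ j → InWindow j → f j ≤ c) → win r f k ≤ ι r * c
    win-≤ {c} 0≤c le = ∑-≤-const r c λ i i<r → shift-≤ (suc i) k 0≤c λ j eq → le j (in-window i<r eq)

    ∣win∣≤ : ∣ win r f k ∣ ≤ win r (∣_∣ ∘ f) k
    ∣win∣≤ = ≤-trans (∣∑∣≤∑∣∣ r _) (≤-reflexive (∑-cong-≗ r λ i → shift-∣∣ (suc i) f k))

  -- The powers of P and the series exp(εP)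

  module Coefficients (r : ℕ) where

    -- q j k is the coefficient of z^k in P(z)^j / j!, where P(z) = z + z²/2 + … + z^r/r.
    q : ℕ → ℕ → ℚ
    q zero    zero    = 1ℚ
    q zero    (suc k) = 0ℚ
    q (suc j) zero    = 0ℚ
    q (suc j) (suc k) = inv (suc k) * win r (q j) (suc k)

    -- Multiplication by P(z).
    P* : (ℕ → ℚ) → ℕ → ℚ
    P* f k = ∑ r λ i → inv (suc i) * shift (suc i) f k

    -- In series form, z d/dz (P^(j+1)/(j+1)!) = z P′ · P^j/j!. The recursion of `q` is this
    -- equation solved for the coefficient.
    θq-suc : ∀ j k → ι k * q (suc j) k ≡ win r (q j) k
    θq-suc j zero    = trans (*-zeroˡ 0ℚ) (sym (∑-zero r λ _ _ → refl))
    θq-suc j (suc k) = begin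
      ι (suc k) * (inv (suc k) * w)  ≡⟨ *-assoc (ι (suc k)) (inv (suc k)) w ⟨
      ι (suc k) * inv (suc k) * w    ≡⟨ cong (_* w) (inv-suc k) ⟩
      1ℚ * w                         ≡⟨ *-identityˡ w ⟩
      w                              ∎
      where
      open ≡-Reasoning
      w = win r (q j) (suc k)

    -- Leibniz rule for the derivation z d/dz and the product P f.
    θP* : ∀ f k → ι k * P* f k ≡ win r f k + P* (λ l → ι l * f l) k
    θP* f k = begin
      ι k * P* f k
        ≡⟨ ∑-*ˡ r (ι k) (λ i → inv (suc i) * shift (suc i) f k) ⟨
      ∑ r (λ i → ι k * (inv (suc i) * shift (suc i) f k))
        ≡⟨ ∑-cong-≗ r term ⟩
      ∑ r (λ i → shift (suc i) f k + inv (suc i) * shift (suc i) (λ l → ι l * f l) k)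
        ≡⟨ ∑-+ r (λ i → shift (suc i) f k) (λ i → inv (suc i) * shift (suc i) (λ l → ι l * f l) k) ⟩
      win r f k + P* (λ l → ι l * f l) k ∎
      where
      open ≡-Reasoning
      rearrange₁ : ∀ a b c → a * (b * c) ≡ b * (a * c)
      rearrange₁ = solve-∀ ℚ-ring
      rearrange₂ : ∀ a b s t → b * (a * s + t) ≡ a * b * s + b * t
      rearrange₂ = solve-∀ ℚ-ring
      term : ∀ i → ι k * (inv (suc i) * shift (suc i) f k) ≡
                   shift (suc i) f k + inv (suc i) * shift (suc i) (λ l → ι l * f l) k
      term i = let s = shift (suc i) f k ; t = shift (suc i) (λ l → ι l * f l) k in begin
        ι k * (inv (suc i) * s)                    ≡⟨ rearrange₁ (ι k) (inv (suc i)) s ⟩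
        inv (suc i) * (ι k * s)                    ≡⟨ cong (inv (suc i) *_) (shift-derivation (suc i) f k) ⟩
        inv (suc i) * (ι (suc i) * s + t)          ≡⟨ rearrange₂ (ι (suc i)) (inv (suc i)) s t ⟩
        ι (suc i) * inv (suc i) * s + inv (suc i) * t ≡⟨ cong (λ x → x * s + inv (suc i) * t) (inv-suc i) ⟩
        1ℚ * s + inv (suc i) * t                   ≡⟨ cong (_+ inv (suc i) * t) (*-identityˡ s) ⟩
        s + inv (suc i) * t                        ∎

    P*-cong : ∀ {f g} k → f ≗ g → P* f k ≡ P* g k
    P*-cong k eq = ∑-cong-≗ r λ i → cong (inv (suc i) *_) (shift-cong (suc i) k λ j _ → eq j)

    -- Multiplication by P commutes with multiplication by z P′.
    P*-win : ∀ f k → P* (win r f) k ≡ win r (P* f) k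
    P*-win f k = begin
      ∑ r (λ i → inv (suc i) * shift (suc i) (win r f) k)
        ≡⟨ ∑-cong-≗ r (λ i → trans (cong (inv (suc i) *_) (shift-∑ (suc i) r (λ j → shift (suc j) f) k))
                                   (sym (∑-*ˡ r (inv (suc i)) (λ j → shift (suc i) (shift (suc j) f) k)))) ⟩
      ∑ r (λ i → ∑ r λ j → inv (suc i) * shift (suc i) (shift (suc j) f) k)
        ≡⟨ ∑-swap r r (λ i j → inv (suc i) * shift (suc i) (shift (suc j) f) k) ⟩
      ∑ r (λ j → ∑ r λ i → inv (suc i) * shift (suc i) (shift (suc j) f) k)
        ≡⟨ ∑-cong-≗ r (λ j → trans (∑-cong-≗ r λ i → cong (inv (suc i) *_) (shift-comm (suc i) (suc j) f k))
                                   (sym (shift-linear (suc j) r (λ i → inv (suc i)) (λ i → shift (suc i) f) k))) ⟩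
      win r (P* f) k ∎
      where open ≡-Reasoning

    -- (j + 1) P^(j+1)/(j+1)! = P · P^j/j!, because both sides have the same derivative.
    mutual
      q-suc : ∀ j k → ι (suc j) * q (suc j) k ≡ P* (q j) k
      q-suc j zero    = trans (*-zeroʳ (ι (suc j))) (sym (∑-zero r λ i _ → *-zeroʳ (inv (suc i))))
      q-suc j (suc k) = ι-cancel k (begin
        ι (suc k) * (ι (suc j) * q (suc j) (suc k))     ≡⟨ rearrange (ι (suc k)) (ι (suc j)) (q (suc j) (suc k)) ⟩
        ι (suc j) * (ι (suc k) * q (suc j) (suc k))     ≡⟨ cong₂ _*_ (ι-suc j) (θq-suc j (suc k)) ⟩
        (1ℚ + ι j) * w                                  ≡⟨ expand (ι j) w ⟩
        w + ι j * w                                     ≡⟨ cong (w +_) (P*-θq j (suc k)) ⟨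
        w + P* (λ l → ι l * q j l) (suc k)              ≡⟨ θP* (q j) (suc k) ⟨
        ι (suc k) * P* (q j) (suc k)                    ∎)
        where
        open ≡-Reasoning
        w = win r (q j) (suc k)
        rearrange : ∀ a b c → a * (b * c) ≡ b * (a * c)
        rearrange = solve-∀ ℚ-ring
        expand : ∀ a w → (1ℚ + a) * w ≡ w + a * w
        expand = solve-∀ ℚ-ring

      -- For exponent j + 1, the derivative is z P′ · P^j/j!, and the factor P is absorbed by
      -- `q-suc` at the lower exponent j; hence the joint induction.
      P*-θq : ∀ j k → P* (λ l → ι l * q j l) k ≡ ι j * win r (q j) k
      P*-θq zero k = trans
        (∑-zero r λ i _ → trans (cong (inv (suc i) *_) (shift-zero (suc i) k λ l _ → θq-zero l)) (*-zeroʳ (inv (suc i))))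
        (sym (*-zeroˡ (win r (q zero) k)))
        where
        θq-zero : ∀ l → ι l * q zero l ≡ 0ℚ
        θq-zero zero    = *-zeroˡ 1ℚ
        θq-zero (suc l) = *-zeroʳ (ι (suc l))
      P*-θq (suc j) k = begin
        P* (λ l → ι l * q (suc j) l) k                  ≡⟨ P*-cong k (θq-suc j) ⟩
        P* (win r (q j)) k                              ≡⟨ P*-win (q j) k ⟩
        win r (P* (q j)) k                              ≡⟨ win-cong r k (λ l _ → q-suc j l) ⟨
        win r (λ l → ι (suc j) * q (suc j) l) k         ≡⟨ ∑-cong-≗ r (λ i → shift-*ˡ (suc i) (ι (suc j)) (q (suc j)) k) ⟩
        ∑ r (λ i → ι (suc j) * shift (suc i) (q (suc j)) k) ≡⟨ ∑-*ˡ r (ι (suc j)) (λ i → shift (suc i) (q (suc j)) k) ⟩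
        ι (suc j) * win r (q (suc j)) k                 ∎
        where open ≡-Reasoning

    q-degree : ∀ j k → j ℕ.* r ℕ.< k → q j k ≡ 0ℚ
    q-degree zero    (suc k) _     = refl
    q-degree (suc j) (suc k) (s≤s jr<k) = trans
      (cong (inv (suc k) *_) (∑-zero r λ i i<r → shift-zero i k λ l i+l≡k → q-degree j l (below i l i<r i+l≡k)))
      (*-zeroʳ (inv (suc k)))
      where
      below : ∀ i l → i ℕ.< r → i ℕ.+ l ≡ k → j ℕ.* r ℕ.< l
      below i l i<r refl = ℕ.+-cancelˡ-< i (j ℕ.* r) l
        (ℕ.<-≤-trans (ℕ.+-monoˡ-< (j ℕ.* r) i<r) jr<k)

    q-order : ∀ j k → k ℕ.< j → q j k ≡ 0ℚ
    q-order (suc j) zero    _         = refl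
    q-order (suc j) (suc k) (s≤s k<j) = trans
      (cong (inv (suc k) *_) (∑-zero r λ i i<r → shift-zero i k λ l i+l≡k →
        q-order j l (ℕ.≤-<-trans (subst (l ℕ.≤_) i+l≡k (ℕ.m≤n+m l i)) k<j)))
      (*-zeroʳ (inv (suc k)))

    0≤q : ∀ j k → 0ℚ ≤ q j k
    0≤q zero    zero    = 0≤ι 1
    0≤q zero    (suc k) = ≤-refl
    0≤q (suc j) zero    = ≤-refl
    0≤q (suc j) (suc k) = 0≤* (0≤inv (suc k)) (0≤∑ r λ i _ →
      subst (_≤ shift i (q j) k) (shift-zero i k λ _ _ → refl) (shift-mono i k λ l _ → 0≤q j l))

    ∑-inv : ∀ n → ∑ n (λ i → inv (suc i)) ≡ H n
    ∑-inv zero    = refl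
    ∑-inv (suc n) = cong (_+ inv (suc n)) (∑-inv n)

    -- Evaluation of P^j/j! at z = 1, where P(1) = H_r. Summation beyond the degree j r loses no
    -- coefficient; a factor z^{i+1} with i < r uses up at most r of the additional room in the
    -- induction.
    ∑-q : ∀ j K → j ℕ.* r ℕ.< K → ∑ K (q j) ≡ powℚ (H r) j * 1/! j
    ∑-q zero    (suc K) _    = trans (∑-vanish {1} {suc K} (q zero) (s≤s z≤n) λ { (suc i) _ → refl }) refl
    ∑-q (suc j) K       jr<K = ι-cancel j (begin
      ι (suc j) * ∑ K (q (suc j))                  ≡⟨ ∑-*ˡ K (ι (suc j)) (q (suc j)) ⟨
      ∑ K (λ k → ι (suc j) * q (suc j) k)          ≡⟨ ∑-cong-≗ K (q-suc j) ⟩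
      ∑ K (P* (q j))                               ≡⟨ ∑-swap K r (λ k i → inv (suc i) * shift (suc i) (q j) k) ⟩
      ∑ r (λ i → ∑ K (λ k → inv (suc i) * shift (suc i) (q j) k))
        ≡⟨ ∑-cong r term ⟩
      ∑ r (λ i → t * inv (suc i))                  ≡⟨ ∑-*ˡ r t (λ i → inv (suc i)) ⟩
      t * ∑ r (λ i → inv (suc i))                  ≡⟨ cong (t *_) (∑-inv r) ⟩
      powℚ (H r) j * 1/! j * H r                   ≡⟨ cong (λ x → powℚ (H r) j * x * H r) (1/!-suc j) ⟨
      powℚ (H r) j * (ι (suc j) * 1/! (suc j)) * H r ≡⟨ rearrange (powℚ (H r) j) (ι (suc j)) (1/! (suc j)) (H r) ⟩
      ι (suc j) * (powℚ (H r) (suc j) * 1/! (suc j)) ∎)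
      where
      open ≡-Reasoning
      t = powℚ (H r) j * 1/! j
      rearrange : ∀ a b c d → a * (b * c) * d ≡ b * (a * d * c)
      rearrange = solve-∀ ℚ-ring
      term : ∀ i → i ℕ.< r → ∑ K (λ k → inv (suc i) * shift (suc i) (q j) k) ≡ t * inv (suc i)
      term i i<r = begin
        ∑ K (λ k → inv (suc i) * shift (suc i) (q j) k)        ≡⟨ ∑-*ˡ K (inv (suc i)) (shift (suc i) (q j)) ⟩
        inv (suc i) * ∑ K (shift (suc i) (q j))                ≡⟨ cong (λ k → inv (suc i) * ∑ k (shift (suc i) (q j))) K≡ ⟨
        inv (suc i) * ∑ (suc i ℕ.+ K′) (shift (suc i) (q j))   ≡⟨ cong (inv (suc i) *_) (∑-shift (suc i) K′ (q j)) ⟩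
        inv (suc i) * ∑ K′ (q j)                               ≡⟨ cong (inv (suc i) *_) (∑-q j K′ jr<K′) ⟩
        inv (suc i) * t                                        ≡⟨ *-comm (inv (suc i)) t ⟩
        t * inv (suc i)                                        ∎
        where
        K′ = K ℕ.∸ suc i
        K≡ : suc i ℕ.+ K′ ≡ K
        K≡ = ℕ.m+[n∸m]≡n (ℕ.≤-trans i<r (ℕ.≤-trans (ℕ.m≤m+n r (j ℕ.* r)) (ℕ.<⇒≤ jr<K)))
        jr<K′ : j ℕ.* r ℕ.< K′
        jr<K′ = ℕ.+-cancelˡ-< (suc i) (j ℕ.* r) K′
          (subst (suc i ℕ.+ j ℕ.* r ℕ.<_) (sym K≡) (ℕ.≤-<-trans (ℕ.+-monoˡ-≤ (j ℕ.* r) i<r) jr<K))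

    -- truncated ε N is the coefficient sequence of ∑_{j ≤ N} (ε P)^j / j!.
    truncated : ℚ → ℕ → ℕ → ℚ
    truncated ε N k = ∑ (suc N) λ j → powℚ ε j * q j k

    -- Since P^j has order j, this is the coefficient of z^k in exp(ε P).
    α : ℚ → ℕ → ℚ
    α ε k = truncated ε k k

    truncated≡α : ∀ ε N k → k ℕ.≤ N → truncated ε N k ≡ α ε k
    truncated≡α ε N k k≤N = ∑-vanish (λ j → powℚ ε j * q j k) (s≤s k≤N) λ j k<j →
      trans (cong (powℚ ε j *_) (q-order j k k<j)) (*-zeroʳ (powℚ ε j))

    -- Termwise form of z d/dz exp(εP) = ε · z P′ · exp(εP): `θq-suc` lowers the power of P by one
    -- and releases one factor ε.
    α-suc : ∀ ε k → ι (suc k) * α ε (suc k) ≡ ε * win r (α ε) (suc k)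
    α-suc ε k = begin
      ι (suc k) * α ε (suc k)
        ≡⟨ ∑-*ˡ (suc (suc k)) (ι (suc k)) (λ j → powℚ ε j * q j (suc k)) ⟨
      ∑ (suc (suc k)) (λ j → ι (suc k) * (powℚ ε j * q j (suc k)))
        ≡⟨ ∑-head (suc k) (λ j → ι (suc k) * (powℚ ε j * q j (suc k))) ⟩
      ι (suc k) * (1ℚ * 0ℚ) + ∑ (suc k) (λ j → ι (suc k) * (powℚ ε (suc j) * q (suc j) (suc k)))
        ≡⟨ cong₂ _+_ (trans (cong (ι (suc k) *_) (*-zeroʳ 1ℚ)) (*-zeroʳ (ι (suc k)))) (∑-cong-≗ (suc k) term) ⟩
      0ℚ + ∑ (suc k) (λ j → ε * (powℚ ε j * win r (q j) (suc k)))
        ≡⟨ +-identityˡ _ ⟩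
      ∑ (suc k) (λ j → ε * (powℚ ε j * win r (q j) (suc k)))
        ≡⟨ ∑-*ˡ (suc k) ε (λ j → powℚ ε j * win r (q j) (suc k)) ⟩
      ε * ∑ (suc k) (λ j → powℚ ε j * win r (q j) (suc k))
        ≡⟨ cong (ε *_) (begin
          ∑ (suc k) (λ j → powℚ ε j * win r (q j) (suc k))
            ≡⟨ ∑-cong-≗ (suc k) (λ j → ∑-*ˡ r (powℚ ε j) (λ i → shift i (q j) k)) ⟨
          ∑ (suc k) (λ j → ∑ r λ i → powℚ ε j * shift i (q j) k)
            ≡⟨ ∑-swap (suc k) r (λ j i → powℚ ε j * shift i (q j) k) ⟩
          ∑ r (λ i → ∑ (suc k) λ j → powℚ ε j * shift i (q j) k)
            ≡⟨ ∑-cong-≗ r (λ i → shift-linear i (suc k) (powℚ ε) q k) ⟨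
          win r (truncated ε k) (suc k)
            -- The window at k + 1 reads only indices l ≤ k, where stopping the exponential at j = k
            -- changes nothing.
            ≡⟨ win-cong r (suc k) (λ { l (s≤s l≤k) → truncated≡α ε k l l≤k }) ⟩
          win r (α ε) (suc k) ∎) ⟩
      ε * win r (α ε) (suc k) ∎
      where
      open ≡-Reasoning
      rearrange : ∀ a b c d → a * (b * c * d) ≡ c * (b * (a * d))
      rearrange = solve-∀ ℚ-ring
      term : ∀ j → ι (suc k) * (powℚ ε (suc j) * q (suc j) (suc k)) ≡ ε * (powℚ ε j * win r (q j) (suc k))
      term j = trans (rearrange (ι (suc k)) (powℚ ε j) ε (q (suc j) (suc k)))
                     (cong (λ x → ε * (powℚ ε j * x)) (θq-suc j (suc k)))

    powℚ-neg : ∀ x j → powℚ (- x) j ≡ powℚ (- 1ℚ) j * powℚ x j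
    powℚ-neg x zero    = refl
    powℚ-neg x (suc j) = trans (cong (_* (- x)) (powℚ-neg x j)) (rearrange (powℚ (- 1ℚ) j) (powℚ x j) x)
      where
      rearrange : ∀ a b x → a * b * (- x) ≡ a * (- 1ℚ) * (b * x)
      rearrange = solve-∀ ℚ-ring

    -- Two evaluations of ∑_{j ≤ N} (-P)^j/j! at z = 1: through the powers of P(1) = H_r, and
    -- through its coefficients, of index at most N r.
    expNegPartial≡∑ : ∀ N → expNegPartial (H r) N ≡ ∑ (suc (N ℕ.* r)) (truncated (- 1ℚ) N)
    expNegPartial≡∑ N = begin
      expNegPartial (H r) N                                                   ≡⟨ as-sum N ⟩
      ∑ (suc N) (λ j → powℚ (- H r) j * 1/! j)                                ≡⟨ ∑-cong (suc N) term ⟩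
      ∑ (suc N) (λ j → ∑ K λ k → powℚ (- 1ℚ) j * q j k)                       ≡⟨ ∑-swap (suc N) K (λ j k → powℚ (- 1ℚ) j * q j k) ⟩
      ∑ K (truncated (- 1ℚ) N)                                                ∎
      where
      open ≡-Reasoning
      K = suc (N ℕ.* r)
      as-sum : ∀ N → expNegPartial (H r) N ≡ ∑ (suc N) (λ j → powℚ (- H r) j * 1/! j)
      as-sum zero    = refl
      as-sum (suc N) = cong (_+ powℚ (- H r) (suc N) * 1/! (suc N)) (as-sum N)
      term : ∀ j → j ℕ.< suc N → powℚ (- H r) j * 1/! j ≡ ∑ K (λ k → powℚ (- 1ℚ) j * q j k)
      term j (s≤s j≤N) = begin
        powℚ (- H r) j * 1/! j                     ≡⟨ cong (_* 1/! j) (powℚ-neg (H r) j) ⟩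
        powℚ (- 1ℚ) j * powℚ (H r) j * 1/! j       ≡⟨ *-assoc (powℚ (- 1ℚ) j) (powℚ (H r) j) (1/! j) ⟩
        powℚ (- 1ℚ) j * (powℚ (H r) j * 1/! j)     ≡⟨ cong (powℚ (- 1ℚ) j *_) (∑-q j K (s≤s (ℕ.*-monoˡ-≤ r j≤N))) ⟨
        powℚ (- 1ℚ) j * ∑ K (q j)                  ≡⟨ ∑-*ˡ K (powℚ (- 1ℚ) j) (q j) ⟨
        ∑ K (λ k → powℚ (- 1ℚ) j * q j k)          ∎

  -- Completion counts as proportions

  module Proportion (p : ℕ → Bool) where

    open Exploration p using (closed#; open#; extended#; good; #good)

    c : ℕ → ℚ
    c n = ι (closed# n) * 1/! n

    -- Division by m! absorbs the factor m counting the choices of the next point, so extending the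
    -- path takes `o (suc m) k` to `o m (suc k)` with coefficient 1.
    o : ℕ → ℕ → ℚ
    o m k = ι (open# m k) * 1/! m

    probS≡c : ∀ n → probS n good ≡ c n
    probS≡c n = trans (/-ι (length (filterᵇ good (perms n))) (n !) {{n ℕ.!≢0}}) (cong (λ l → ι l * 1/! n) (#good n))

    c-suc : ∀ m → ι (suc m) * c (suc m) ≡ o m 0
    c-suc m = trans (rearrange (ι (suc m)) (ι (open# m 0)) (1/! (suc m))) (cong (ι (open# m 0) *_) (1/!-suc m))
      where
      rearrange : ∀ a b c → a * (b * c) ≡ b * (a * c)
      rearrange = solve-∀ ℚ-ring

    private
      o-step : ∀ m k → o m k ≡ ι (𝟙 (p (suc k))) * c m + ι m * ι (extended# m k) * 1/! m
      o-step m k = begin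
        ι (𝟙 b ℕ.* x ℕ.+ m ℕ.* y) * 1/! m                 ≡⟨ cong (_* 1/! m) (ι-+ (𝟙 b ℕ.* x) (m ℕ.* y)) ⟩
        (ι (𝟙 b ℕ.* x) + ι (m ℕ.* y)) * 1/! m             ≡⟨ cong₂ (λ u v → (u + v) * 1/! m) (ι-* (𝟙 b) x) (ι-* m y) ⟩
        (ι (𝟙 b) * ι x + ι m * ι y) * 1/! m               ≡⟨ distribute (ι (𝟙 b)) (ι x) (ι m * ι y) (1/! m) ⟩
        ι (𝟙 b) * (ι x * 1/! m) + ι m * ι y * 1/! m       ∎
        where
        open ≡-Reasoning
        b = p (suc k)
        x = closed# m
        y = extended# m k
        distribute : ∀ a b c d → (a * b + c) * d ≡ a * (b * d) + c * d
        distribute = solve-∀ ℚ-ring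

      o-zero : ∀ k → o 0 k ≡ ι (𝟙 (p (suc k))) * c 0
      o-zero k = trans (o-step 0 k) (cancel (ι (𝟙 (p (suc k))) * c 0) (ι 0) (1/! 0))
        where
        cancel : ∀ a b d → a + 0ℚ * b * d ≡ a
        cancel = solve-∀ ℚ-ring

      o-suc : ∀ m k → o (suc m) k ≡ ι (𝟙 (p (suc k))) * c (suc m) + o m (suc k)
      o-suc m k = trans (o-step (suc m) k) (cong (λ x → ι (𝟙 (p (suc k))) * c (suc m) + x)
        (trans (rearrange (ι (suc m)) (ι (open# m (suc k))) (1/! (suc m))) (cong (ι (open# m (suc k)) *_) (1/!-suc m))))
        where
        rearrange : ∀ a b c → a * b * c ≡ b * (a * c)
        rearrange = solve-∀ ℚ-ring

    module _ {k : ℕ} where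

      o-zero-true : p (suc k) ≡ true → o 0 k ≡ c 0
      o-zero-true eq = trans (o-zero k) (trans (cong (λ b → ι (𝟙 b) * c 0) eq) (*-identityˡ (c 0)))

      o-zero-false : p (suc k) ≡ false → o 0 k ≡ 0ℚ
      o-zero-false eq = trans (o-zero k) (trans (cong (λ b → ι (𝟙 b) * c 0) eq) (*-zeroˡ (c 0)))

      o-suc-true : ∀ m → p (suc k) ≡ true → o (suc m) k ≡ c (suc m) + o m (suc k)
      o-suc-true m eq = trans (o-suc m k)
        (cong (_+ o m (suc k)) (trans (cong (λ b → ι (𝟙 b) * c (suc m)) eq) (*-identityˡ (c (suc m)))))

      o-suc-false : ∀ m → p (suc k) ≡ false → o (suc m) k ≡ o m (suc k)
      o-suc-false m eq = trans (o-suc m k) (trans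
        (cong (_+ o m (suc k)) (trans (cong (λ b → ι (𝟙 b) * c (suc m)) eq) (*-zeroˡ (c (suc m))))) (+-identityˡ (o m (suc k))))

  -- Recurrences of ν and κ and their identification with coefficients

  ≤ᵇ-true : ∀ {m n} → m ℕ.≤ n → (m ℕ.≤ᵇ n) ≡ true
  ≤ᵇ-true m≤n = Equivalence.to Bool.T-≡ (ℕ.≤⇒≤ᵇ m≤n)

  ≤ᵇ-false : ∀ {m n} → ¬ m ℕ.≤ n → (m ℕ.≤ᵇ n) ≡ false
  ≤ᵇ-false {m} {n} m≰n with m ℕ.≤ᵇ n in eq
  ... | false = refl
  ... | true  = contradiction (ℕ.≤ᵇ⇒≤ m n (Equivalence.from Bool.T-≡ eq)) m≰n

  ∸-step : ∀ {r k} → k ℕ.< r → r ℕ.∸ k ≡ suc (r ℕ.∸ suc k)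
  ∸-step {suc r} {k} (s≤s k≤r) = ℕ.+-∸-assoc 1 k≤r

  module _ (r : ℕ) where

    ν≡c : ∀ n → ν n r ≡ Proportion.c (ℕ._≤ᵇ r) n
    ν≡c = Proportion.probS≡c (ℕ._≤ᵇ r)

    ν-zero : ν 0 r ≡ 1ℚ
    ν-zero = ν≡c 0

    ν-suc : ∀ n → ι (suc n) * ν (suc n) r ≡ win r (λ k → ν k r) (suc n)
    ν-suc n = begin
      ι (suc n) * ν (suc n) r       ≡⟨ cong (ι (suc n) *_) (ν≡c (suc n)) ⟩
      ι (suc n) * c (suc n)         ≡⟨ c-suc n ⟩
      o n 0                         ≡⟨ o≡ n 0 ⟩
      ∑ r (λ i → shift i c n)       ≡⟨ win-cong r {λ k → ν k r} {c} (suc n) (λ k _ → ν≡c k) ⟨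
      win r (λ k → ν k r) (suc n)   ∎
      where
      open ≡-Reasoning
      open Proportion (ℕ._≤ᵇ r)
      -- A path of k + 1 points may be closed at the lengths k + 1, ..., r, leaving m, m - 1, ...
      -- untouched points.
      o≡ : ∀ m k → o m k ≡ ∑ (r ℕ.∸ k) (λ i → shift i c m)
      o≡ m k with k ℕ.<? r
      o≡ zero k    | yes k<r = trans (o-zero-true (≤ᵇ-true k<r)) (sym (trans
        (cong (λ s → ∑ s (λ i → shift i c 0)) (∸-step k<r))
        (trans (∑-head (r ℕ.∸ suc k) (λ i → shift i c 0))
          (trans (cong (c 0 +_) (∑-zero (r ℕ.∸ suc k) λ _ _ → refl)) (+-identityʳ (c 0))))))
      o≡ (suc m) k | yes k<r = trans (o-suc-true m (≤ᵇ-true k<r)) (sym (trans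
        (cong (λ s → ∑ s (λ i → shift i c (suc m))) (∸-step k<r))
        (trans (∑-head (r ℕ.∸ suc k) (λ i → shift i c (suc m))) (cong (c (suc m) +_) (sym (o≡ m (suc k)))))))
      o≡ zero k    | no k≮r = trans (o-zero-false (≤ᵇ-false k≮r))
        (sym (cong (λ s → ∑ s (λ i → shift i c 0)) (ℕ.m≤n⇒m∸n≡0 (ℕ.≮⇒≥ k≮r))))
      o≡ (suc m) k | no k≮r = trans (o-suc-false m (≤ᵇ-false k≮r)) (trans (o≡ m (suc k)) (trans
        (cong (λ s → ∑ s (λ i → shift i c m)) (ℕ.m≤n⇒m∸n≡0 (ℕ.m≤n⇒m≤1+n (ℕ.≮⇒≥ k≮r))))
        (sym (cong (λ s → ∑ s (λ i → shift i c (suc m))) (ℕ.m≤n⇒m∸n≡0 (ℕ.≮⇒≥ k≮r))))))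

    κ≡c : ∀ n → κ n r ≡ Proportion.c (r ℕ.<ᵇ_) n
    κ≡c = Proportion.probS≡c (r ℕ.<ᵇ_)

    κ-zero : κ 0 r ≡ 1ℚ
    κ-zero = κ≡c 0

    κ-suc : ∀ n → ι (suc n) * κ (suc n) r ≡ shift r (prefix (λ k → κ k r)) n
    κ-suc n = begin
      ι (suc n) * κ (suc n) r              ≡⟨ cong (ι (suc n) *_) (κ≡c (suc n)) ⟩
      ι (suc n) * c (suc n)                ≡⟨ c-suc n ⟩
      o n 0                                ≡⟨ o≡ n 0 ⟩
      shift r (prefix c) n                 ≡⟨ shift-cong r n (λ j _ → ∑-cong-≗ (suc j) κ≡c) ⟨
      shift r (prefix (λ k → κ k r)) n     ∎
      where
      open ≡-Reasoning
      open Proportion (r ℕ.<ᵇ_)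
      -- A path of k + 1 points first needs r - k more points to reach length r + 1; from then on it
      -- may be closed at any time.
      o≡ : ∀ m k → o m k ≡ shift (r ℕ.∸ k) (prefix c) m
      o≡ m k with r ℕ.≤? k
      o≡ zero k    | yes r≤k = trans (o-zero-true (≤ᵇ-true (s≤s r≤k))) (trans (sym (+-identityˡ (c 0)))
        (sym (cong (λ s → shift s (prefix c) 0) (ℕ.m≤n⇒m∸n≡0 r≤k))))
      o≡ (suc m) k | yes r≤k = begin
        o (suc m) k                              ≡⟨ o-suc-true m (≤ᵇ-true (s≤s r≤k)) ⟩
        c (suc m) + o m (suc k)                  ≡⟨ cong (c (suc m) +_) (o≡ m (suc k)) ⟩
        c (suc m) + shift (r ℕ.∸ suc k) (prefix c) m
          ≡⟨ cong (λ s → c (suc m) + shift s (prefix c) m) (ℕ.m≤n⇒m∸n≡0 (ℕ.m≤n⇒m≤1+n r≤k)) ⟩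
        c (suc m) + prefix c m                   ≡⟨ +-comm (c (suc m)) (prefix c m) ⟩
        prefix c (suc m)                         ≡⟨ cong (λ s → shift s (prefix c) (suc m)) (ℕ.m≤n⇒m∸n≡0 r≤k) ⟨
        shift (r ℕ.∸ k) (prefix c) (suc m)       ∎
      o≡ zero k    | no r≰k = trans (o-zero-false (≤ᵇ-false (r≰k ∘ ℕ.s≤s⁻¹)))
        (sym (cong (λ s → shift s (prefix c) 0) (∸-step (ℕ.≰⇒> r≰k))))
      o≡ (suc m) k | no r≰k = trans (o-suc-false m (≤ᵇ-false (r≰k ∘ ℕ.s≤s⁻¹))) (trans (o≡ m (suc k))
        (sym (cong (λ s → shift s (prefix c) (suc m)) (∸-step (ℕ.≰⇒> r≰k)))))

    open Coefficients r

    ν≡α : ∀ n → ν n r ≡ α 1ℚ n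
    ν≡α = <-rec _ step
      where
      step : ∀ n → (∀ {j} → j ℕ.< n → ν j r ≡ α 1ℚ j) → ν n r ≡ α 1ℚ n
      step zero    rec = ν-zero
      step (suc n) rec = ι-cancel n (begin
        ι (suc n) * ν (suc n) r         ≡⟨ ν-suc n ⟩
        win r (λ k → ν k r) (suc n)     ≡⟨ win-cong r (suc n) (λ _ → rec) ⟩
        win r (α 1ℚ) (suc n)            ≡⟨ *-identityˡ _ ⟨
        1ℚ * win r (α 1ℚ) (suc n)       ≡⟨ α-suc 1ℚ n ⟨
        ι (suc n) * α 1ℚ (suc n)        ∎)
        where open ≡-Reasoning

    -- The series S = exp(-P)/(1 - z) has S′/S = -P′ + 1/(1 - z) = z^r/(1 - z), because P′ = (1 -
    -- z^r)/(1 - z). This is the recurrence of κ.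
    prefix-α-suc : ∀ n → ι (suc n) * prefix (α (- 1ℚ)) (suc n) ≡ shift r (prefix (prefix (α (- 1ℚ)))) n
    prefix-α-suc n = begin
      ι (suc n) * (s n + a (suc n))                       ≡⟨ *-distribˡ-+ (ι (suc n)) (s n) (a (suc n)) ⟩
      ι (suc n) * s n + ι (suc n) * a (suc n)             ≡⟨ cong₂ (λ x y → x * s n + y) (ι-suc n) (α-suc (- 1ℚ) n) ⟩
      (1ℚ + ι n) * s n + - 1ℚ * win r a (suc n)           ≡⟨ cong (λ x → x + - 1ℚ * win r a (suc n)) (expand (ι n) (s n)) ⟩
      ι n * s n + s n + - 1ℚ * win r a (suc n)            ≡⟨ cong (λ x → ι n * s n + x + - 1ℚ * win r a (suc n)) (prefix-window r a n) ⟩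
      ι n * s n + (win r a (suc n) + shift r s n) + - 1ℚ * win r a (suc n) ≡⟨ cancel (ι n * s n) (win r a (suc n)) (shift r s n) ⟩
      ι n * s n + shift r s n                             ≡⟨ collect n ⟩
      shift r (prefix s) n                                ∎
      where
      open ≡-Reasoning
      a = α (- 1ℚ)
      s = prefix a
      expand : ∀ x y → (1ℚ + x) * y ≡ x * y + y
      expand = solve-∀ ℚ-ring
      cancel : ∀ x w y → x + (w + y) + - 1ℚ * w ≡ x + y
      cancel = solve-∀ ℚ-ring
      shift-prefix : ∀ i f n → shift i (prefix f) (suc n) ≡ shift i (prefix f) n + shift i f (suc n)
      shift-prefix zero    f n       = refl
      shift-prefix (suc zero) f zero = refl
      shift-prefix (suc (suc i)) f zero = refl
      shift-prefix (suc i) f (suc n) = shift-prefix i f n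
      -- By induction n s_n = s_0 + ... + s_{n-1-r}, and s_{n-r} is the next summand.
      collect : ∀ n → ι n * s n + shift r s n ≡ shift r (prefix s) n
      collect zero    = trans (cong (_+ shift r s 0) (*-zeroˡ (s 0))) (trans (+-identityˡ (shift r s 0)) (at-zero r))
        where
        at-zero : ∀ i → shift i s 0 ≡ shift i (prefix s) 0
        at-zero zero    = sym (+-identityˡ (s 0))
        at-zero (suc i) = refl
      collect (suc n) = trans (cong (_+ shift r s (suc n)) (prefix-α-suc n)) (sym (shift-prefix r s n))

    κ≡prefix-α : ∀ n → κ n r ≡ prefix (α (- 1ℚ)) n
    κ≡prefix-α = <-rec _ step
      where
      step : ∀ n → (∀ {j} → j ℕ.< n → κ j r ≡ prefix (α (- 1ℚ)) j) → κ n r ≡ prefix (α (- 1ℚ)) n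
      step zero    rec = κ-zero
      step (suc n) rec = ι-cancel n (begin
        ι (suc n) * κ (suc n) r                           ≡⟨ κ-suc n ⟩
        shift r (prefix (λ k → κ k r)) n
          ≡⟨ shift-cong r n (λ j j≤n → ∑-cong (suc j) λ i i≤j → rec (ℕ.≤-trans i≤j (s≤s j≤n))) ⟩
        shift r (prefix (prefix (α (- 1ℚ)))) n            ≡⟨ prefix-α-suc n ⟨
        ι (suc n) * prefix (α (- 1ℚ)) (suc n)             ∎)
        where open ≡-Reasoning

  -- Estimates for the coefficients and the limit

  module Estimates (r-1 : ℕ) where

    r : ℕ
    r = suc r-1

    open Coefficients r

    v a s : ℕ → ℚ
    v = α 1ℚ
    a = α (- 1ℚ)
    s = prefix a

    powℚ-1 : ∀ j → powℚ 1ℚ j ≡ 1ℚ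
    powℚ-1 zero    = refl
    powℚ-1 (suc j) = trans (*-identityʳ (powℚ 1ℚ j)) (powℚ-1 j)

    ∣powℚ-neg-1∣ : ∀ j → ∣ powℚ (- 1ℚ) j ∣ ≡ 1ℚ
    ∣powℚ-neg-1∣ zero    = refl
    ∣powℚ-neg-1∣ (suc j) = trans (∣p*q∣≡∣p∣*∣q∣ (powℚ (- 1ℚ) j) (- 1ℚ)) (trans (*-identityʳ ∣ powℚ (- 1ℚ) j ∣) (∣powℚ-neg-1∣ j))

    term-1 : ∀ j k → powℚ 1ℚ j * q j k ≡ q j k
    term-1 j k = trans (cong (_* q j k) (powℚ-1 j)) (*-identityˡ (q j k))

    0≤term : ∀ j k → 0ℚ ≤ powℚ 1ℚ j * q j k
    0≤term j k = subst (0ℚ ≤_) (sym (term-1 j k)) (0≤q j k)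

    0≤v : ∀ k → 0ℚ ≤ v k
    0≤v k = 0≤∑ (suc k) λ j _ → 0≤term j k

    -- Absolute values remove the signs because `q` is nonnegative. This controls the indices k > N,
    -- where the truncated exponential does not yet have the coefficient a_k.
    ∣truncated∣≤v : ∀ N k → ∣ truncated (- 1ℚ) N k ∣ ≤ v k
    ∣truncated∣≤v N k = begin
      ∣ truncated (- 1ℚ) N k ∣                        ≤⟨ ∣∑∣≤∑∣∣ (suc N) (λ j → powℚ (- 1ℚ) j * q j k) ⟩
      ∑ (suc N) (λ j → ∣ powℚ (- 1ℚ) j * q j k ∣)     ≡⟨ ∑-cong-≗ (suc N) abs-term ⟩
      truncated 1ℚ N k                                ≤⟨ below ⟩
      v k                                             ∎
      where
      open ≤-Reasoning
      abs-term : ∀ j → ∣ powℚ (- 1ℚ) j * q j k ∣ ≡ powℚ 1ℚ j * q j k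
      abs-term j = trans (∣p*q∣≡∣p∣*∣q∣ (powℚ (- 1ℚ) j) (q j k))
        (cong₂ _*_ (trans (∣powℚ-neg-1∣ j) (sym (powℚ-1 j))) (0≤p⇒∣p∣≡p (0≤q j k)))
      below : truncated 1ℚ N k ≤ v k
      below with ℕ.≤-total N k
      ... | inj₁ N≤k = ∑-extend (λ j → powℚ 1ℚ j * q j k) (s≤s N≤k) λ j _ → 0≤term j k
      ... | inj₂ k≤N = ≤-reflexive (truncated≡α 1ℚ N k k≤N)

    θv : ∀ k → ι k * v k ≡ win r v k
    θv zero    = trans (*-zeroˡ (v 0)) (sym (∑-zero r λ _ _ → refl))
    θv (suc k) = trans (α-suc 1ℚ k) (*-identityˡ (win r v (suc k)))

    -- From the window at k to the one at k + 1, v_k enters and v_{k-r} leaves.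
    v-step : ∀ k → v (suc k) + inv (suc k) * shift r v k ≡ v k
    v-step k = ι-cancel k (begin
      ι (suc k) * (v (suc k) + inv (suc k) * x)               ≡⟨ expand (ι (suc k)) (v (suc k)) (inv (suc k)) x ⟩
      ι (suc k) * v (suc k) + ι (suc k) * inv (suc k) * x     ≡⟨ cong₂ (λ y z → y + z * x) (θv (suc k)) (inv-suc k) ⟩
      win r v (suc k) + 1ℚ * x                                ≡⟨ cong (λ y → win r v (suc k) + y) (*-identityˡ x) ⟩
      ∑ (suc r) (λ i → shift i v k)                           ≡⟨ ∑-head r (λ i → shift i v k) ⟩
      v k + win r v k                                         ≡⟨ cong (λ y → v k + y) (θv k) ⟨
      v k + ι k * v k                                         ≡⟨ collect (ι k) (v k) ⟩
      (1ℚ + ι k) * v k                                        ≡⟨ cong (_* v k) (ι-suc k) ⟨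
      ι (suc k) * v k                                         ∎)
      where
      open ≡-Reasoning
      x = shift r v k
      expand : ∀ a b c x → a * (b + c * x) ≡ a * b + a * c * x
      expand = solve-∀ ℚ-ring
      collect : ∀ a b → b + a * b ≡ (1ℚ + a) * b
      collect = solve-∀ ℚ-ring

    0≤shift-v : ∀ i k → 0ℚ ≤ shift i v k
    0≤shift-v i k = subst (_≤ shift i v k) (shift-zero i {λ _ → 0ℚ} k λ _ _ → refl) (shift-mono i k λ j _ → 0≤v j)

    v-anti : ∀ {m n} → m ℕ.≤ n → v n ≤ v m
    v-anti {m} {n} m≤n = ≤-trans (≤-reflexive (cong v (sym (ℕ.m+[n∸m]≡n m≤n)))) (go (n ℕ.∸ m))
      where
      v-suc : ∀ k → v (suc k) ≤ v k
      v-suc k = subst₂ _≤_ (+-identityʳ (v (suc k))) (v-step k)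
        (+-monoʳ-≤ (v (suc k)) (0≤* (0≤inv (suc k)) (0≤shift-v r k)))
      go : ∀ d → v (m ℕ.+ d) ≤ v m
      go zero    = ≤-reflexive (cong v (ℕ.+-identityʳ m))
      go (suc d) = ≤-trans (≤-reflexive (cong v (ℕ.+-suc m d))) (≤-trans (v-suc (m ℕ.+ d)) (go d))

    v≡1 : ∀ k → k ℕ.≤ r → v k ≡ 1ℚ
    v≡1 zero    _   = refl
    v≡1 (suc k) k<r = begin
      v (suc k)                                  ≡⟨ +-identityʳ (v (suc k)) ⟨
      v (suc k) + 0ℚ                             ≡⟨ cong (λ y → v (suc k) + y) (*-zeroʳ (inv (suc k))) ⟨
      v (suc k) + inv (suc k) * 0ℚ               ≡⟨ cong (λ y → v (suc k) + inv (suc k) * y) (shift-vanish r v k k<r) ⟨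
      v (suc k) + inv (suc k) * shift r v k      ≡⟨ v-step k ⟩
      v k                                        ≡⟨ v≡1 k (ℕ.<⇒≤ k<r) ⟩
      1ℚ                                         ∎
      where open ≡-Reasoning

    -- While k - r ≤ r, `v-step` subtracts exactly 1/(k + 1). Combinatorially, at most 2r + 1 points
    -- leave room for only one cycle longer than r, and one of length l occurs with probability 1/l.
    v+H : ∀ j → j ℕ.≤ suc r → v (r ℕ.+ j) + H (r ℕ.+ j) ≡ 1ℚ + H r
    v+H zero    _         = trans (cong (λ k → v k + H k) (ℕ.+-identityʳ r)) (cong (_+ H r) (v≡1 r ℕ.≤-refl))
    v+H (suc j) (s≤s j≤r) = begin
      v (r ℕ.+ suc j) + H (r ℕ.+ suc j)                  ≡⟨ cong (λ k → v k + H k) (ℕ.+-suc r j) ⟩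
      v (suc k) + (H k + inv (suc k))                    ≡⟨ rearrange (v (suc k)) (H k) (inv (suc k)) ⟩
      v (suc k) + inv (suc k) * 1ℚ + H k                 ≡⟨ cong (λ x → v (suc k) + inv (suc k) * x + H k) (trans (shift-+ r v j) (v≡1 j j≤r)) ⟨
      v (suc k) + inv (suc k) * shift r v k + H k        ≡⟨ cong (_+ H k) (v-step k) ⟩
      v k + H k                                          ≡⟨ v+H j (ℕ.m≤n⇒m≤1+n j≤r) ⟩
      1ℚ + H r                                           ∎
      where
      open ≡-Reasoning
      k = r ℕ.+ j
      rearrange : ∀ x h i → x + (h + i) ≡ x + i * 1ℚ + h
      rearrange = solve-∀ ℚ-ring

    -- By monotonicity k = 2r + 1 is the worst index, with value 1 - (H_{2r+1} - H_r). The
    -- difference is largest at r = 1, where H_3 - H_1 = 5/6.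
    1≤6v : ∀ k → k ℕ.≤ r ℕ.+ suc r → 1ℚ ≤ ι 6 * v k
    1≤6v k k≤ = begin
      1ℚ                                                 ≡⟨⟩
      ι 6 * (1ℚ - ι 5 * inv 6)                               ≤⟨ *-monoˡ (0≤ι 6) (begin
        1ℚ - ι 5 * inv 6                                       ≡⟨ add (H r) (ι 5 * inv 6) ⟩
        (1ℚ + H r) - (ι 5 * inv 6 + H r)                       ≤⟨ +-monoʳ-≤ (1ℚ + H r) (neg-antimono-≤ (harmonic r-1)) ⟩
        (1ℚ + H r) - H (r ℕ.+ suc r)                       ≡⟨ cong (_- H (r ℕ.+ suc r)) (v+H (suc r) ℕ.≤-refl) ⟨
        v (r ℕ.+ suc r) + H (r ℕ.+ suc r) - H (r ℕ.+ suc r) ≡⟨ cancel (v (r ℕ.+ suc r)) (H (r ℕ.+ suc r)) ⟩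
        v (r ℕ.+ suc r)                                    ≤⟨ v-anti k≤ ⟩
        v k                                                ∎) ⟩
      ι 6 * v k                                          ∎
      where
      open ≤-Reasoning
      add : ∀ h c → 1ℚ - c ≡ (1ℚ + h) - (c + h)
      add = solve-∀ ℚ-ring
      cancel : ∀ x h → x + h - h ≡ x
      cancel = solve-∀ ℚ-ring
      -- H_{2m+1} - H_m decreases in m.
      harmonic : ∀ m → H (suc m ℕ.+ suc (suc m)) ≤ ι 5 * inv 6 + H (suc m)
      harmonic zero    = ≤-reflexive refl
      harmonic (suc m) = begin
        H (suc (suc m) ℕ.+ suc (suc (suc m)))            ≡⟨ cong (H ∘ suc) (ℕ.+-suc (suc m) (suc (suc m))) ⟩
        H n + inv (suc n) + inv (suc (suc n))            ≤⟨ +-monoʳ-≤ (H n + inv (suc n)) (inv-anti (ℕ.n≤1+n n)) ⟩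
        H n + inv (suc n) + inv (suc n)                  ≡⟨ +-assoc (H n) (inv (suc n)) (inv (suc n)) ⟩
        H n + (inv (suc n) + inv (suc n))                ≤⟨ +-mono-≤ (harmonic m) (≤-reflexive halves) ⟩
        ι 5 * inv 6 + H (suc m) + inv (suc (suc m))          ≡⟨ +-assoc (ι 5 * inv 6) (H (suc m)) (inv (suc (suc m))) ⟩
        ι 5 * inv 6 + H (suc (suc m))                        ∎
        where
        n = suc m ℕ.+ suc (suc m)
        halves : inv (suc n) + inv (suc n) ≡ inv (suc (suc m))
        halves = ι-cancel (suc m) (trans (double (ι (suc (suc m))) (inv (suc n))) (trans
          (cong (_* inv (suc n)) (sym (ι-+ (suc (suc m)) (suc (suc m))))) (trans (inv-suc n) (sym (inv-suc (suc m))))))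
          where
          double : ∀ a b → a * (b + b) ≡ (a + a) * b
          double = solve-∀ ℚ-ring

    s-early : ∀ k → suc k ℕ.≤ r → s (suc k) ≡ 0ℚ
    s-early k k<r = ι-cancel k (trans (prefix-α-suc r k) (trans (shift-vanish r (prefix s) k k<r) (sym (*-zeroʳ (ι (suc k))))))

    prefix-s : ∀ j → j ℕ.≤ r → prefix s j ≡ 1ℚ
    prefix-s j j≤r = trans (∑-head j s) (trans (cong (s 0 +_) (∑-zero j λ i i<j → s-early i (ℕ.≤-trans i<j j≤r))) refl)

    -- On at most 2r + 1 but more than r points, cycles all longer than r mean a single cycle
    -- through everything, which has probability 1/k on k points.
    s-middle : ∀ j → j ℕ.≤ r → s (suc (r ℕ.+ j)) ≡ inv (suc (r ℕ.+ j))
    s-middle j j≤r = ι-cancel (r ℕ.+ j) (trans (prefix-α-suc r (r ℕ.+ j))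
      (trans (shift-+ r (prefix s) j) (trans (prefix-s j j≤r) (sym (inv-suc (r ℕ.+ j))))))

    D : ℚ
    D = inv r * inv r * ι 6

    0≤D : 0ℚ ≤ D
    0≤D = 0≤* (0≤* (0≤inv r) (0≤inv r)) (0≤ι 6)

    ∣a∣-middle : ∀ j → suc j ℕ.≤ r → ∣ a (suc (suc (r ℕ.+ j))) ∣ ≤ D * v (suc (suc (r ℕ.+ j)))
    ∣a∣-middle j j<r = begin
      ∣ a k ∣                            ≡⟨ cong ∣_∣ (difference (s (suc (r ℕ.+ j))) (a k)) ⟩
      ∣ s k - s (suc (r ℕ.+ j)) ∣        ≡⟨ cong₂ (λ x y → ∣ x - y ∣) s-k (s-middle j (ℕ.<⇒≤ j<r)) ⟩
      ∣ y - x ∣                          ≡⟨ cong ∣_∣ (inv-difference (r ℕ.+ j)) ⟩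
      ∣ - (x * y) ∣                      ≡⟨ trans (∣-p∣≡∣p∣ (x * y)) (0≤p⇒∣p∣≡p (0≤* (0≤inv (suc (r ℕ.+ j))) (0≤inv k))) ⟩
      x * y                              ≤⟨ *-monoʳ (0≤inv k) (inv-anti r-1≤) ⟩
      inv r * y                          ≤⟨ *-monoˡ (0≤inv r) (inv-anti (ℕ.m≤n⇒m≤1+n r-1≤)) ⟩
      inv r * inv r                      ≡⟨ *-identityʳ (inv r * inv r) ⟨
      inv r * inv r * 1ℚ                 ≤⟨ *-monoˡ (0≤* (0≤inv r) (0≤inv r)) (1≤6v k k≤) ⟩
      inv r * inv r * (ι 6 * v k)        ≡⟨ *-assoc (inv r * inv r) (ι 6) (v k) ⟨
      D * v k                            ∎
      where
      open ≤-Reasoning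
      k = suc (suc (r ℕ.+ j))
      x = inv (suc (r ℕ.+ j))
      y = inv k
      difference : ∀ x y → y ≡ (x + y) - x
      difference = solve-∀ ℚ-ring
      s-k : s k ≡ y
      s-k = subst (λ i → s (suc i) ≡ inv (suc i)) (ℕ.+-suc r j) (s-middle (suc j) j<r)
      r-1≤ : r-1 ℕ.≤ r ℕ.+ j
      r-1≤ = ℕ.≤-trans (ℕ.n≤1+n r-1) (ℕ.m≤m+n r j)
      k≤ : k ℕ.≤ r ℕ.+ suc r
      k≤ = subst (k ℕ.≤_) (sym (ℕ.+-suc r r)) (s≤s (subst (ℕ._≤ r ℕ.+ r) (ℕ.+-suc r j) (ℕ.+-monoʳ-≤ r j<r)))

    -- From k = 2r + 2 on, the whole window k - r, ..., k - 1 lies at or above r + 2. There the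
    -- recurrences of a and v differ only in sign, so the triangle inequality passes the bound on.
    ∣a∣≤ : ∀ k → suc (suc r) ℕ.≤ k → ∣ a k ∣ ≤ D * v k
    ∣a∣≤ = <-rec _ step
      where
      open ≤-Reasoning
      step : ∀ k → (∀ {j} → j ℕ.< k → suc (suc r) ℕ.≤ j → ∣ a j ∣ ≤ D * v j) → suc (suc r) ℕ.≤ k → ∣ a k ∣ ≤ D * v k
      step (suc (suc k)) rec (s≤s (s≤s r≤k)) with k ℕ.<? r ℕ.+ r
      ... | yes k<2r = subst (λ i → ∣ a (suc (suc i)) ∣ ≤ D * v (suc (suc i))) (ℕ.m+[n∸m]≡n r≤k)
        (∣a∣-middle (k ℕ.∸ r) (ℕ.+-cancelˡ-< r (k ℕ.∸ r) r (subst (ℕ._< r ℕ.+ r) (sym (ℕ.m+[n∸m]≡n r≤k)) k<2r)))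
      ... | no k≮2r = ι-cancel-≤ (suc k) (begin
        ι K * ∣ a K ∣                    ≡⟨ cong (_* ∣ a K ∣) (0≤p⇒∣p∣≡p (0≤ι K)) ⟨
        ∣ ι K ∣ * ∣ a K ∣                ≡⟨ ∣p*q∣≡∣p∣*∣q∣ (ι K) (a K) ⟨
        ∣ ι K * a K ∣                    ≡⟨ cong ∣_∣ (α-suc (- 1ℚ) (suc k)) ⟩
        ∣ - 1ℚ * win r a K ∣             ≡⟨ trans (∣p*q∣≡∣p∣*∣q∣ (- 1ℚ) (win r a K)) (*-identityˡ ∣ win r a K ∣) ⟩
        ∣ win r a K ∣                    ≤⟨ ∣win∣≤ r K ⟩
        win r (∣_∣ ∘ a) K                ≤⟨ win-mono r K (λ { j (j<K , K≤r+j) → rec j<K (late j K≤r+j) }) ⟩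
        win r (λ j → D * v j) K          ≡⟨ trans (∑-cong-≗ r (λ i → shift-*ˡ (suc i) D v K)) (∑-*ˡ r D (λ i → shift (suc i) v K)) ⟩
        D * win r v K                    ≡⟨ cong (D *_) (θv K) ⟨
        D * (ι K * v K)                  ≡⟨ swap D (ι K) (v K) ⟩
        ι K * (D * v K)                  ∎)
        where
        K = suc (suc k)
        swap : ∀ a b c → a * (b * c) ≡ b * (a * c)
        swap = solve-∀ ℚ-ring
        late : ∀ j → K ℕ.≤ r ℕ.+ j → suc (suc r) ℕ.≤ j
        late j K≤r+j = ℕ.+-cancelˡ-≤ r (suc (suc r)) j (ℕ.≤-trans
          (ℕ.≤-reflexive (trans (ℕ.+-suc r (suc r)) (cong suc (ℕ.+-suc r r))))
          (ℕ.≤-trans (s≤s (s≤s (ℕ.≮⇒≥ k≮2r))) K≤r+j))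

    -- The bound reproduces itself over blocks of length r: the first block costs at most r v_n, the
    -- rest at most 2r v_{n+r} ≤ r v_n. The sum is padded to a whole number of blocks.
    v-tail : ∀ L n → r ℕ.≤ n → ∑ L (λ i → v (suc n ℕ.+ i)) ≤ (ι r + ι r) * v n
    v-tail L n r≤n = ≤-trans (∑-extend (λ i → v (suc n ℕ.+ i)) (ℕ.m≤m*n L r) λ i _ → 0≤v (suc n ℕ.+ i)) (blocks L n r≤n)
      where
      open ≤-Reasoning
      -- Here 2r ≤ n + r, and (n + r) v_{n+r} is the window v_n, ..., v_{n+r-1} of r terms, each at
      -- most v_n.
      decay : ∀ n → r ℕ.≤ n → (ι r + ι r) * v (n ℕ.+ r) ≤ ι r * v n
      decay n r≤n = begin
        (ι r + ι r) * v (n ℕ.+ r)        ≡⟨ cong (_* v (n ℕ.+ r)) (ι-+ r r) ⟨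
        ι (r ℕ.+ r) * v (n ℕ.+ r)        ≤⟨ *-monoʳ (0≤v (n ℕ.+ r)) (ι-mono-≤ (ℕ.+-monoˡ-≤ r r≤n)) ⟩
        ι (n ℕ.+ r) * v (n ℕ.+ r)        ≡⟨ θv (n ℕ.+ r) ⟩
        win r v (n ℕ.+ r)                ≤⟨ win-≤ r (n ℕ.+ r) (0≤v n) (λ { j (_ , n+r≤r+j) →
                                              v-anti (ℕ.+-cancelˡ-≤ r n j (subst (ℕ._≤ r ℕ.+ j) (ℕ.+-comm n r) n+r≤r+j)) }) ⟩
        ι r * v n                        ∎
      blocks : ∀ L n → r ℕ.≤ n → ∑ (L ℕ.* r) (λ i → v (suc n ℕ.+ i)) ≤ (ι r + ι r) * v n
      blocks zero    n r≤n = 0≤* (+-mono-≤ (0≤ι r) (0≤ι r)) (0≤v n)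
      blocks (suc L) n r≤n = begin
        ∑ (r ℕ.+ L ℕ.* r) (λ i → v (suc n ℕ.+ i))                  ≡⟨ ∑-split r (L ℕ.* r) (λ i → v (suc n ℕ.+ i)) ⟩
        ∑ r (λ i → v (suc n ℕ.+ i)) + ∑ (L ℕ.* r) (λ i → v (suc n ℕ.+ (r ℕ.+ i)))
          ≤⟨ +-mono-≤ (∑-≤-const r (v n) λ i _ → v-anti (ℕ.≤-trans (ℕ.n≤1+n n) (ℕ.m≤m+n (suc n) i)))
                      (≤-reflexive (∑-cong-≗ (L ℕ.* r) λ i → cong (v ∘ suc) (sym (ℕ.+-assoc n r i)))) ⟩
        ι r * v n + ∑ (L ℕ.* r) (λ i → v (suc (n ℕ.+ r) ℕ.+ i))    ≤⟨ +-monoʳ-≤ (ι r * v n) (blocks L (n ℕ.+ r) (ℕ.≤-trans r≤n (ℕ.m≤m+n n r))) ⟩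
        ι r * v n + (ι r + ι r) * v (n ℕ.+ r)                      ≤⟨ +-monoʳ-≤ (ι r * v n) (decay n r≤n) ⟩
        ι r * v n + ι r * v n                                      ≡⟨ *-distribʳ-+ (v n) (ι r) (ι r) ⟨
        (ι r + ι r) * v n                                          ∎

    -- The coefficients up to n add up to s_n exactly, those from n + 1 to M are a_k and obey
    -- `∣a∣≤`, and those beyond M are only known to be dominated by v_k.
    expNegPartial-error : ∀ n M → suc r ℕ.≤ n → n ℕ.≤ M →
            ∣ expNegPartial (H r) M - s n ∣ ≤ ι 12 * v n * inv r + (ι r + ι r) * v M
    expNegPartial-error n M r<n n≤M = begin
      ∣ expNegPartial (H r) M - s n ∣                ≡⟨ cong (λ x → ∣ x - s n ∣) (expNegPartial≡∑ M) ⟩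
      ∣ ∑ (suc (M ℕ.* r)) t - s n ∣                  ≡⟨ cong (λ k → ∣ ∑ k t - s n ∣) lengths ⟩
      ∣ ∑ (suc n ℕ.+ (L₁ ℕ.+ L₂)) t - s n ∣          ≡⟨ cong (λ x → ∣ x - s n ∣) (∑-split (suc n) (L₁ ℕ.+ L₂) t) ⟩
      ∣ ∑ (suc n) t + rest - s n ∣                   ≡⟨ cong (λ x → ∣ x + rest - s n ∣) (∑-cong (suc n) λ { k (s≤s k≤n) → truncated≡α (- 1ℚ) M k (ℕ.≤-trans k≤n n≤M) }) ⟩
      ∣ s n + rest - s n ∣                           ≡⟨ cong ∣_∣ (cancel (s n) rest) ⟩
      ∣ rest ∣                                       ≤⟨ ∣∑∣≤∑∣∣ (L₁ ℕ.+ L₂) (λ i → t (suc n ℕ.+ i)) ⟩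
      ∑ (L₁ ℕ.+ L₂) (λ i → ∣ t (suc n ℕ.+ i) ∣)      ≡⟨ ∑-split L₁ L₂ (λ i → ∣ t (suc n ℕ.+ i) ∣) ⟩
      ∑ L₁ (λ i → ∣ t (suc n ℕ.+ i) ∣) + ∑ L₂ (λ i → ∣ t (suc n ℕ.+ (L₁ ℕ.+ i)) ∣)
        ≤⟨ +-mono-≤ (∑-mono L₁ near) (∑-mono L₂ far) ⟩
      ∑ L₁ (λ i → D * v (suc n ℕ.+ i)) + ∑ L₂ (λ i → v (suc M ℕ.+ i))
        ≡⟨ cong (_+ ∑ L₂ (λ i → v (suc M ℕ.+ i))) (∑-*ˡ L₁ D (λ i → v (suc n ℕ.+ i))) ⟩
      D * ∑ L₁ (λ i → v (suc n ℕ.+ i)) + ∑ L₂ (λ i → v (suc M ℕ.+ i))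
        ≤⟨ +-mono-≤ (*-monoˡ 0≤D (v-tail L₁ n r≤n)) (v-tail L₂ M (ℕ.≤-trans r≤n n≤M)) ⟩
      D * ((ι r + ι r) * v n) + (ι r + ι r) * v M    ≡⟨ cong (_+ (ι r + ι r) * v M) constant ⟩
      ι 12 * v n * inv r + (ι r + ι r) * v M         ∎
      where
      open ≤-Reasoning
      t = truncated (- 1ℚ) M
      L₁ = M ℕ.∸ n
      L₂ = M ℕ.* r ℕ.∸ M
      rest = ∑ (L₁ ℕ.+ L₂) (λ i → t (suc n ℕ.+ i))
      r≤n = ℕ.<⇒≤ r<n
      n+L₁≡M : n ℕ.+ L₁ ≡ M
      n+L₁≡M = ℕ.m+[n∸m]≡n n≤M
      lengths : suc (M ℕ.* r) ≡ suc n ℕ.+ (L₁ ℕ.+ L₂)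
      lengths = cong suc (trans (sym (ℕ.m+[n∸m]≡n (ℕ.m≤m*n M r)))
        (trans (cong (ℕ._+ L₂) (sym n+L₁≡M)) (ℕ.+-assoc n L₁ L₂)))
      cancel : ∀ x y → x + y - x ≡ y
      cancel = solve-∀ ℚ-ring
      near : ∀ i → i ℕ.< L₁ → ∣ t (suc n ℕ.+ i) ∣ ≤ D * v (suc n ℕ.+ i)
      near i i<L₁ = subst (λ x → ∣ x ∣ ≤ D * v (suc n ℕ.+ i)) (sym (truncated≡α (- 1ℚ) M (suc n ℕ.+ i) ≤M))
        (∣a∣≤ (suc n ℕ.+ i) (s≤s (ℕ.≤-trans r<n (ℕ.m≤m+n n i))))
        where
        ≤M : suc n ℕ.+ i ℕ.≤ M
        ≤M = subst₂ ℕ._≤_ (ℕ.+-suc n i) n+L₁≡M (ℕ.+-monoʳ-≤ n i<L₁)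
      far : ∀ i → i ℕ.< L₂ → ∣ t (suc n ℕ.+ (L₁ ℕ.+ i)) ∣ ≤ v (suc M ℕ.+ i)
      far i _ = subst (λ k → ∣ t (suc n ℕ.+ (L₁ ℕ.+ i)) ∣ ≤ v (suc k))
        (trans (sym (ℕ.+-assoc n L₁ i)) (cong (ℕ._+ i) n+L₁≡M)) (∣truncated∣≤v M (suc n ℕ.+ (L₁ ℕ.+ i)))
      -- The factor 6/r² of the comparison times the 2r of the tail gives 12/r.
      constant : D * ((ι r + ι r) * v n) ≡ ι 12 * v n * inv r
      constant = trans (rearrange (inv r) (ι r) (v n)) (trans (cong (λ x → ι 12 * v n * inv r * x) (inv-suc r-1)) (*-identityʳ _))
        where
        rearrange : ∀ i x y → i * i * ι 6 * ((x + x) * y) ≡ ι 12 * y * i * (x * i)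
        rearrange = solve-∀ ℚ-ring

    -- The recurrence with v ≤ v_0 = 1 gives M v_M ≤ r, so 2r v_M ≤ 2r²/M.
    v-limit : ∀ ε → 0ℚ < ε → ∃[ N ] (∀ M → N ℕ.≤ M → (ι r + ι r) * v M ≤ ε)
    v-limit ε 0<ε with archimedean ε 0<ε ((r ℕ.+ r) ℕ.* r)
    ... | N , large = suc N , bound
      where
      open ≤-Reasoning
      bound : ∀ M → suc N ℕ.≤ M → (ι r + ι r) * v M ≤ ε
      bound (suc M) (s≤s N≤M) = ι-cancel-≤ M (begin
        ι (suc M) * ((ι r + ι r) * v (suc M))    ≡⟨ swap (ι (suc M)) (ι r + ι r) (v (suc M)) ⟩
        (ι r + ι r) * (ι (suc M) * v (suc M))    ≡⟨ cong ((ι r + ι r) *_) (θv (suc M)) ⟩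
        (ι r + ι r) * win r v (suc M)            ≤⟨ *-monoˡ (+-mono-≤ (0≤ι r) (0≤ι r)) (win-≤ r (suc M) (0≤ι 1) λ j _ → v-anti {0} {j} z≤n) ⟩
        (ι r + ι r) * (ι r * 1ℚ)                 ≡⟨ cong₂ _*_ (sym (ι-+ r r)) (*-identityʳ (ι r)) ⟩
        ι (r ℕ.+ r) * ι r                        ≡⟨ ι-* (r ℕ.+ r) r ⟨
        ι ((r ℕ.+ r) ℕ.* r)                      ≤⟨ large ⟩
        ε * ι N                                  ≤⟨ *-monoˡ (<⇒≤ 0<ε) (ι-mono-≤ (ℕ.m≤n⇒m≤1+n N≤M)) ⟩
        ε * ι (suc M)                            ≡⟨ *-comm ε (ι (suc M)) ⟩
        ι (suc M) * ε                            ∎)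
        where
        swap : ∀ a b c → a * (b * c) ≡ b * (a * c)
        swap = solve-∀ ℚ-ring

    absDiffExpNegLeq : ∀ n → r ℕ.< n → AbsDiffExpNegLeq (H r) (κ n r) (ι 12 * ν n r * inv r)
    absDiffExpNegLeq n r<n = lower , upper
      where
      b = ι 12 * ν n r * inv r
      E = expNegPartial (H r)
      start : ∀ ε → 0ℚ < ε → ℕ
      -- M ≥ n is what `expNegPartial-error` asks for; the other bound makes its remainder 2r v_M at
      -- most ε.
      start ε 0<ε = n ℕ.⊔ proj₁ (v-limit ε 0<ε)
      close : ∀ ε 0<ε M → start ε 0<ε ℕ.≤ M → ∣ E M - κ n r ∣ ≤ b + ε
      close ε 0<ε M start≤M = subst₂ (λ x y → ∣ E M - x ∣ ≤ ι 12 * y * inv r + ε)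
        (sym (κ≡prefix-α r n)) (sym (ν≡α r n))
        (≤-trans (expNegPartial-error n M r<n (ℕ.m⊔n≤o⇒m≤o n N start≤M))
          (+-monoʳ-≤ (ι 12 * v n * inv r) (proj₂ (v-limit ε 0<ε) M (ℕ.m⊔n≤o⇒n≤o n N start≤M))))
        where N = proj₁ (v-limit ε 0<ε)
      lower : LimGeq E (κ n r - b)
      lower ε 0<ε = start ε 0<ε , λ M start≤M → subst (_≤ E M) (regroup (κ n r) b ε)
        (∣-∣≤⇒-≤ (E M) (κ n r) (b + ε) (close ε 0<ε M start≤M))
        where
        regroup : ∀ x y z → x - (y + z) ≡ (x - y) - z
        regroup = solve-∀ ℚ-ring
      upper : LimLeq E (κ n r + b)
      upper ε 0<ε = start ε 0<ε , λ M start≤M → subst (E M ≤_) (sym (+-assoc (κ n r) b ε))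
        (∣-∣≤⇒≤+ (E M) (κ n r) (b + ε) (close ε 0<ε M start≤M))

open import Data.Nat using (_≤_; _<_)
open import Data.Rational using (ℚ; 0ℚ; _*_) renaming (_<_ to _<ℚ_)
open import Data.Rational.Properties using (positive⁻¹)

theorem3 : ∃[ C ] (0ℚ <ℚ C × (∀ (n r : ℕ) → 5 ≤ r → r < n →
    AbsDiffExpNegLeq (H r) (κ n r) (C * ν n r * inv r)))
theorem3 = Analysis.ι 12 , positive⁻¹ (Analysis.ι 12) , λ { n (suc r) _ r<n → Analysis.Estimates.absDiffExpNegLeq r n r<n }
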